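{- Given an edge-weighted graph $G$, a real $r > 0$, a partition $\mathcal{P}$ of $V(G)$, a total ordering $\preceq$ of $\mathcal{P}$, an integer $m \geq 0$, and a set $A \subseteq \mathcal{P}$ such that $|A| \geq (2mc)^{c+1}$, where $c = \mathrm{wcol}_{r}(G,\mathcal{P},\preceq)$, one can in polynomial time find $S \subseteq \mathcal{P}$ and $B \subseteq A \setminus S$ such that $|S| \leq c$, $|B| \geq m$, and every two distinct $X_1,X_2 \in B$ are at distance more than $r$ in $G-\bigcup S$.
   Context: An edge-weighted graph is a finite simple graph $G$ with a nonnegative real weight on each edge; distances and lengths of paths are with respect to the weights. The distance between two vertex sets is the minimum distance between a vertex of one and a vertex of the other ($+\infty$ if no path exists). For a family $S$ of sets, $\bigcup S$ denotes the union of its members. For a partition $\mathcal{P}$ of $V(G)$, a total order $\preceq$ on $\mathcal{P}$ and a real $r>0$, a part $Y \in \mathcal{P}$ is weakly $r$-reachable from $X \in \mathcal{P}$ if there exists a path of length at most $r$ from a vertex of $X$ to a vertex of $Y$ in the graph $G[\bigcup \{Z \in \mathcal{P} : Y \preceq Z\}]$. Let $\mathrm{WReach}_r[G,\mathcal{P},\preceq,X]$ be the set of all $Y\in\mathcal{P}$ weakly $r$-reachable from $X$, and $\mathrm{wcol}_r(G,\mathcal{P},\preceq) := \max_{X\in\mathcal{P}} |\mathrm{WReach}_r[G,\mathcal{P},\preceq,X]|$. -}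

module Defs where

open import Algebra.Bundles using (CommutativeRing)
open import Data.Bool.Base using (Bool; if_then_else_; true; false)
open import Data.Fin.Base using (Fin; toℕ)
open import Data.Fin.Properties using (_≟_; any?)
open import Data.Fin.Subset using (Subset; _∈_; _-_; ∣_∣)
open import Data.Fin.Subset.Properties using (_∈?_; x∈p⇒∣p-x∣<∣p∣)
import Data.List.Extrema
import Data.List.Extrema.Nat as Extremaℕ
open import Data.List.Base as List
  using (List; []; _∷_; _++_; foldr; filter; cartesianProduct; concatMap; allFin)
import Data.List.Membership.Propositional as ListMem
open import Data.List.Membership.Propositional.Properties
  using (∈-++⁺ˡ; ∈-++⁺ʳ; ∈-concatMap⁺; ∈-allFin; ∈-map⁺; ∈-map⁻)
open import Data.List.Relation.Unary.All as All using (All; []; _∷_)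
open import Data.List.Relation.Unary.Any as Any using (Any; here)
open import Data.Nat.Base as ℕ using (ℕ; zero; suc)
import Data.Nat.GeneralisedArithmetic as ℕ
import Data.Nat.Properties as ℕ
open import Data.Product.Base using (∃; ∃₂; _×_; _,_; proj₁; proj₂)
import Data.Vec.Base as Vec
open import Function.Base using (_∘_)
open import Function.Definitions using (StrictlySurjective)
open import Level using (0ℓ)
open import Relation.Binary.Bundles using (TotalOrder)
open import Relation.Binary.Core using (Rel)
import Relation.Binary.Construct.Add.Supremum.NonStrict as AddSup
import Relation.Binary.Construct.Add.Supremum.Strict as AddSupStrict
import Relation.Binary.Construct.NonStrictToStrict as ToStrict
open import Relation.Binary.Definitions using (Decidable; Symmetric; Irreflexive)
open import Relation.Binary.PropositionalEquality.Core using (_≡_; refl; cong; trans)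
open import Relation.Binary.Structures using (IsDecTotalOrder)
open import Relation.Nullary.Construct.Add.Supremum using (_⁺; ⊤⁺; [_])
open import Relation.Nullary.Decidable using (Dec; yes; no; does; map′; _×-dec_)
open import Relation.Nullary.Negation using (¬_; contradiction)
import Relation.Unary as Unary
open import Relation.Unary using (Pred)

-- The real numbers, axiomatised classically as a (the) Dedekind-complete
-- ordered field; the order is decidable, as it is for the classical reals.
record Reals : Set₁ where
  field
    commutativeRing : CommutativeRing 0ℓ 0ℓ

  open CommutativeRing commutativeRing public
    using (Carrier; _≈_; _+_; _*_; -_; 0#; 1#)

  infix 4 _≤_

  field
    _≤_             : Rel Carrier 0ℓ
    isDecTotalOrder : IsDecTotalOrder _≈_ _≤_
    0≉1             : ¬ (0# ≈ 1#)
    inverse         : ∀ x → ¬ (x ≈ 0#) → ∃ λ y → x * y ≈ 1#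
    +-mono          : ∀ x {y z} → y ≤ z → x + y ≤ x + z
    *-nonNegative   : ∀ {x y} → 0# ≤ x → 0# ≤ y → 0# ≤ x * y

  UpperBound : Pred Carrier 0ℓ → Pred Carrier 0ℓ
  UpperBound P b = ∀ x → P x → x ≤ b

  field
    complete : (P : Pred Carrier 0ℓ) → ∃ P → ∃ (UpperBound P) →
               ∃ λ s → UpperBound P s × (∀ b → UpperBound P b → s ≤ b)

  open IsDecTotalOrder isDecTotalOrder public using (_≤?_; isTotalOrder)
  open ToStrict _≈_ _≤_ public using (_<_)
  open AddSup _≤_ public using (_≤⁺_; ≤⁺-isTotalOrder)
  open AddSupStrict _<_ public using (_<⁺_)

  ≤⁺-totalOrder : TotalOrder 0ℓ 0ℓ 0ℓ
  ≤⁺-totalOrder = record { isTotalOrder = ≤⁺-isTotalOrder isTotalOrder }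

  minimum : List (Carrier ⁺) → Carrier ⁺
  minimum = Data.List.Extrema.min ≤⁺-totalOrder ⊤⁺

comprehension : ∀ {n} {P : Pred (Fin n) 0ℓ} → Unary.Decidable P → Subset n
comprehension P? = Vec.tabulate (does ∘ P?)

elements : ∀ {n} → Subset n → List (Fin n)
elements S = filter (_∈? S) (allFin _)

-- A partition of Fin n into k parts, the part with index X being the fibre of
-- `part` over X. Surjectivity says that the parts are nonempty, so distinct
-- indices are distinct parts, and sets of parts are subsets of Fin k.
record Partition (n k : ℕ) : Set where
  field
    part       : Fin n → Fin k
    surjective : StrictlySurjective _≡_ part

  block : Fin k → Subset n
  block X = comprehension (λ v → part v ≟ X)

  ⋃ : Subset k → Subset n
  ⋃ S = comprehension (λ v → part v ∈? S)

module Graphs (ℝ : Reals) where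

  open Reals ℝ

  -- `weight u v` carries no information unless u and v are adjacent.
  record WeightedGraph (n : ℕ) : Set₁ where
    field
      Adj         : Rel (Fin n) 0ℓ
      adj?        : Decidable Adj
      adj-sym     : Symmetric Adj
      adj-irrefl  : Irreflexive _≡_ Adj
      weight      : Fin n → Fin n → Carrier
      weight-sym  : ∀ {u v} → Adj u v → weight u v ≈ weight v u
      nonNegative : ∀ {u v} → Adj u v → 0# ≤ weight u v

  module _ {n : ℕ} (G : WeightedGraph n) where

    open WeightedGraph G

    infixr 5 _∷⟨_⟩_

    -- Paths of the induced subgraph G[U]. A vertex that has been visited is
    -- removed from U, so the vertices of a path are distinct.
    data Path (U : Subset n) : Fin n → Fin n → Set where
      [_]     : ∀ {v} → v ∈ U → Path U v v
      _∷⟨_⟩_ : ∀ {u v w} → u ∈ U → Adj u v → Path (U - u) v w → Path U u w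

    length : ∀ {U u v} → Path U u v → Carrier
    length [ _ ]                      = 0#
    length (_∷⟨_⟩_ {u} {v} _ _ p) = weight u v + length p

    trivialPaths : ∀ {U u v} → u ∈ U → Dec (u ≡ v) → List (Path U u v)
    trivialPaths u∈U (yes refl) = [ u∈U ] ∷ []
    trivialPaths u∈U (no _)     = []

    extend : ∀ {U u v w} → u ∈ U → Dec (Adj u v) →
             List (Path (U - u) v w) → List (Path U u w)
    extend u∈U (yes e) ps = List.map (u∈U ∷⟨ e ⟩_) ps
    extend u∈U (no _)  _  = []

    mutual

      -- The first argument bounds the number of vertices of the paths.
      paths : ℕ → ∀ U u v → List (Path U u v)
      paths zero    U u v = []
      paths (suc f) U u v = pathsFrom f U u v (u ∈? U)

      pathsFrom : ℕ → ∀ U u v → Dec (u ∈ U) → List (Path U u v)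
      pathsFrom f U u v (no _)    = []
      pathsFrom f U u v (yes u∈U) =
        trivialPaths u∈U (u ≟ v) ++
        concatMap (λ w → extend u∈U (adj? u w) (paths f (U - u) w v)) (allFin n)

    pathLengths : ∀ U u v → List Carrier
    pathLengths U u v = List.map length (paths ∣ U ∣ U u v)

    private
      extend-complete : ∀ {U u v w} (u∈U : u ∈ U) (e? : Dec (Adj u v)) → Adj u v →
                        ∀ {q : Path (U - u) v w} {ps} → q ListMem.∈ ps →
                        ∃ λ q′ → q′ ListMem.∈ extend u∈U e? ps ×
                                 weight u v + length q ≡ length q′
      extend-complete u∈U (yes e) _ q∈ = _ , ∈-map⁺ (u∈U ∷⟨ e ⟩_) q∈ , refl
      extend-complete u∈U (no ¬e) e _  = contradiction e ¬e

      trivialPaths-complete : ∀ {U v} (v∈U : v ∈ U) (v≟v : Dec (v ≡ v)) →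
                              ∃ λ q → q ListMem.∈ trivialPaths v∈U v≟v × 0# ≡ length q
      trivialPaths-complete v∈U (yes refl) = _ , here refl , refl
      trivialPaths-complete v∈U (no v≢v)   = contradiction refl v≢v

      paths-complete : ∀ f {U u v} → ∣ U ∣ ℕ.≤ f → (p : Path U u v) →
                       ∃ λ q → q ListMem.∈ paths f U u v × length p ≡ length q
      paths-complete zero ∣U∣≤0 [ u∈U ] =
        contradiction (ℕ.<-≤-trans (x∈p⇒∣p-x∣<∣p∣ u∈U) ∣U∣≤0) λ ()
      paths-complete zero ∣U∣≤0 (u∈U ∷⟨ _ ⟩ _) =
        contradiction (ℕ.<-≤-trans (x∈p⇒∣p-x∣<∣p∣ u∈U) ∣U∣≤0) λ ()
      paths-complete (suc f) {U} {u} _ [ u∈U ] with u ∈? U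
      ... | no u∉U = contradiction u∈U u∉U
      ... | yes u∈U′ with q , q∈ , eq ← trivialPaths-complete u∈U′ (u ≟ u) =
        q , ∈-++⁺ˡ q∈ , eq
      paths-complete (suc f) {U} {u} {v} ∣U∣≤ (_∷⟨_⟩_ {v = w} u∈U e p) with u ∈? U
      ... | no u∉U = contradiction u∈U u∉U
      ... | yes u∈U′
        with q , q∈ , p≡q ← paths-complete f
               (ℕ.s≤s⁻¹ (ℕ.<-≤-trans (x∈p⇒∣p-x∣<∣p∣ u∈U) ∣U∣≤)) p
        with q′ , q′∈ , q≡q′ ← extend-complete u∈U′ (adj? u w) e q∈
        = q′ , ∈-++⁺ʳ (trivialPaths u∈U′ (u ≟ v))
                 (∈-concatMap⁺ _ (ListMem.lose (∈-allFin w) q′∈)) ,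
          trans (cong (weight u w +_) p≡q) q≡q′

    pathLengths-complete : ∀ {U u v} (p : Path U u v) →
                           length p ListMem.∈ pathLengths U u v
    pathLengths-complete p with q , q∈ , eq ← paths-complete _ ℕ.≤-refl p
      rewrite eq = ∈-map⁺ length q∈

    pathLengths-sound : ∀ {U u v ℓ} → ℓ ListMem.∈ pathLengths U u v →
                        ∃ λ (p : Path U u v) → ℓ ≡ length p
    pathLengths-sound ℓ∈ with p , _ , eq ← ∈-map⁻ length ℓ∈ = p , eq

    -- The distance between the vertex sets X and Y in G[U]; ⊤⁺ is +∞.
    dist : (U X Y : Subset n) → Carrier ⁺
    dist U X Y = minimum (concatMap (λ (x , y) → List.map [_] (pathLengths U x y))
                                    (cartesianProduct (elements X) (elements Y)))

    shortPath? : ∀ U r u v → Dec (∃ λ (p : Path U u v) → length p ≤ r)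
    shortPath? U r u v = map′ sound complete′ (Any.any? (_≤? r) (pathLengths U u v))
      where
      sound : Any (_≤ r) (pathLengths U u v) → ∃ λ (p : Path U u v) → length p ≤ r
      sound short with ℓ , ℓ∈ , ℓ≤r ← ListMem.find short
        with p , refl ← pathLengths-sound {U} {u} {v} ℓ∈ = p , ℓ≤r

      complete′ : (∃ λ (p : Path U u v) → length p ≤ r) → Any (_≤ r) (pathLengths U u v)
      complete′ (p , p≤r) = ListMem.lose (pathLengths-complete p) p≤r

    module _ {k : ℕ} (𝒫 : Partition n k)
             {_⪯_ : Rel (Fin k) 0ℓ} (⪯-ord : IsDecTotalOrder _≡_ _⪯_) where

      open Partition 𝒫
      open IsDecTotalOrder ⪯-ord using () renaming (_≤?_ to _⪯?_)

      WeaklyReachable : Carrier → (X Y : Fin k) → Set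
      WeaklyReachable r X Y =
        ∃₂ λ x y → x ∈ block X × y ∈ block Y ×
          ∃ λ (p : Path (⋃ (comprehension (Y ⪯?_))) x y) → length p ≤ r

      weaklyReachable? : ∀ r X Y → Dec (WeaklyReachable r X Y)
      weaklyReachable? r X Y =
        any? λ x → any? λ y →
          x ∈? block X ×-dec y ∈? block Y ×-dec shortPath? _ r x y

      WReach : Carrier → Fin k → Subset k
      WReach r X = comprehension (weaklyReachable? r X)

      wcol : Carrier → ℕ
      wcol r = Extremaℕ.max 0 (List.map (λ X → ∣ WReach r X ∣) (allFin k))

-- Algorithms are programs of a first-order functional language over naturals,
-- reals, Booleans, pairs and lists, whose only loops are `iter` (bounded by a
-- number) and `fold` (bounded by a list). Running time counts evaluation steps
-- of call-by-value evaluation. Naturals and reals can only be added and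
-- compared, each at unit cost, and 0 is the only real constant: this is the
-- additive real RAM up to polynomial factors, so T steps enlarge the bit size
-- of rational data by at most O(T), and every polynomial-time procedure on
-- finite data can be written with a polynomially long loop.
infixr 6 _⊗_

data Ty : Set where
  nat real bool : Ty
  list          : Ty → Ty
  _⊗_           : Ty → Ty → Ty

Ctx : Set
Ctx = List Ty

-- |V|, weighted edges, r, |𝒫|, (vertex, part) pairs, the relation ⪯, m, A
Input : Ctx
Input = nat ∷ list (nat ⊗ nat ⊗ real) ∷ real ∷ nat ∷
        list (nat ⊗ nat) ∷ list (nat ⊗ nat) ∷ nat ∷ list nat ∷ []

data Program (Γ : Ctx) : Ty → Set where
  var          : ∀ {A} → A ListMem.∈ Γ → Program Γ A
  let′         : ∀ {A B} → Program Γ A → Program (A ∷ Γ) B → Program Γ B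
  true false   : Program Γ bool
  if           : ∀ {A} → Program Γ bool → Program Γ A → Program Γ A → Program Γ A
  zero         : Program Γ nat
  suc          : Program Γ nat → Program Γ nat
  _+ₙ_         : Program Γ nat → Program Γ nat → Program Γ nat
  _≤ₙ_         : Program Γ nat → Program Γ nat → Program Γ bool
  iter         : ∀ {A} → Program Γ nat → Program Γ A → Program (A ∷ Γ) A → Program Γ A
  0ᵣ           : Program Γ real
  _+ᵣ_         : Program Γ real → Program Γ real → Program Γ real
  _≤ᵣ_         : Program Γ real → Program Γ real → Program Γ bool
  pair         : ∀ {A B} → Program Γ A → Program Γ B → Program Γ (A ⊗ B)
  fst          : ∀ {A B} → Program Γ (A ⊗ B) → Program Γ A
  snd          : ∀ {A B} → Program Γ (A ⊗ B) → Program Γ B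
  nil          : ∀ {A} → Program Γ (list A)
  cons         : ∀ {A} → Program Γ A → Program Γ (list A) → Program Γ (list A)
  match        : ∀ {A B} → Program Γ (list A) → Program Γ B →
                 Program (A ∷ list A ∷ Γ) B → Program Γ B
  fold         : ∀ {A B} → Program Γ (list A) → Program Γ B →
                 Program (A ∷ B ∷ Γ) B → Program Γ B

module Semantics (ℝ : Reals) where

  open Reals ℝ

  ⟦_⟧ : Ty → Set
  ⟦ nat    ⟧ = ℕ
  ⟦ real   ⟧ = Carrier
  ⟦ bool   ⟧ = Bool
  ⟦ list A ⟧ = List ⟦ A ⟧
  ⟦ A ⊗ B  ⟧ = ⟦ A ⟧ × ⟦ B ⟧

  Env : Ctx → Set
  Env = All ⟦_⟧

  caseList : {A B : Set} → List A → B → (A → List A → B) → B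
  caseList []       b f = b
  caseList (x ∷ xs) b f = f x xs

  value : ∀ {Γ A} → Program Γ A → Env Γ → ⟦ A ⟧
  value (var x)        ρ = All.lookup ρ x
  value (let′ s t)     ρ = value t (value s ρ ∷ ρ)
  value true           ρ = true
  value false          ρ = false
  value (if b s t)     ρ = if value b ρ then value s ρ else value t ρ
  value zero           ρ = zero
  value (suc t)        ρ = suc (value t ρ)
  value (s +ₙ t)       ρ = value s ρ ℕ.+ value t ρ
  value (s ≤ₙ t)       ρ = does (value s ρ ℕ.≤? value t ρ)
  value (iter l s t)   ρ = ℕ.fold (value s ρ) (λ a → value t (a ∷ ρ)) (value l ρ)
  value 0ᵣ             ρ = 0#
  value (s +ᵣ t)       ρ = value s ρ + value t ρ
  value (s ≤ᵣ t)       ρ = does (value s ρ ≤? value t ρ)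
  value (pair s t)     ρ = value s ρ , value t ρ
  value (fst t)        ρ = proj₁ (value t ρ)
  value (snd t)        ρ = proj₂ (value t ρ)
  value nil            ρ = []
  value (cons s t)     ρ = value s ρ ∷ value t ρ
  value (match l s t)  ρ = caseList (value l ρ) (value s ρ) (λ a as → value t (a ∷ as ∷ ρ))
  value (fold l s t)   ρ = foldr (λ a b → value t (a ∷ b ∷ ρ)) (value s ρ) (value l ρ)

  iterCost : {A : Set} → (A → A) → (A → ℕ) → A → ℕ → ℕ
  iterCost f κ a zero    = 0
  iterCost f κ a (suc l) = suc (κ (ℕ.fold a f l)) ℕ.+ iterCost f κ a l

  foldCost : {A B : Set} → (A → B → B) → (A → B → ℕ) → B → List A → ℕ
  foldCost f κ b []       = 0
  foldCost f κ b (a ∷ as) = suc (κ a (foldr f b as)) ℕ.+ foldCost f κ b as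

  cost : ∀ {Γ A} → Program Γ A → Env Γ → ℕ
  cost (var _)        ρ = 1
  cost (let′ s t)     ρ = suc (cost s ρ ℕ.+ cost t (value s ρ ∷ ρ))
  cost true           ρ = 1
  cost false          ρ = 1
  cost (if b s t)     ρ = suc (cost b ρ ℕ.+ (if value b ρ then cost s ρ else cost t ρ))
  cost zero           ρ = 1
  cost (suc t)        ρ = suc (cost t ρ)
  cost (s +ₙ t)       ρ = suc (cost s ρ ℕ.+ cost t ρ)
  cost (s ≤ₙ t)       ρ = suc (cost s ρ ℕ.+ cost t ρ)
  cost (iter l s t)   ρ = suc (cost l ρ ℕ.+ cost s ρ ℕ.+
    iterCost (λ a → value t (a ∷ ρ)) (λ a → cost t (a ∷ ρ)) (value s ρ) (value l ρ))
  cost 0ᵣ             ρ = 1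
  cost (s +ᵣ t)       ρ = suc (cost s ρ ℕ.+ cost t ρ)
  cost (s ≤ᵣ t)       ρ = suc (cost s ρ ℕ.+ cost t ρ)
  cost (pair s t)     ρ = suc (cost s ρ ℕ.+ cost t ρ)
  cost (fst t)        ρ = suc (cost t ρ)
  cost (snd t)        ρ = suc (cost t ρ)
  cost nil            ρ = 1
  cost (cons s t)     ρ = suc (cost s ρ ℕ.+ cost t ρ)
  cost (match l s t)  ρ = suc (cost l ρ ℕ.+
    caseList (value l ρ) (cost s ρ) (λ a as → cost t (a ∷ as ∷ ρ)))
  cost (fold l s t)   ρ = suc (cost l ρ ℕ.+ cost s ρ ℕ.+
    foldCost (λ a b → value t (a ∷ b ∷ ρ)) (λ a b → cost t (a ∷ b ∷ ρ)) (value s ρ) (value l ρ))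

  open Graphs ℝ

  indices : ∀ {n} → Subset n → List ℕ
  indices S = List.map toℕ (elements S)

  encodeRel : ∀ {m n} {R : Fin m → Fin n → Set} →
              (∀ i j → Dec (R i j)) → List (ℕ × ℕ)
  encodeRel {m} {n} R? =
    List.map (λ (i , j) → toℕ i , toℕ j)
      (filter (λ (i , j) → R? i j) (cartesianProduct (allFin m) (allFin n)))

  -- Every edge is listed in both directions.
  encodeEdges : ∀ {n} → WeightedGraph n → List (ℕ × ℕ × Carrier)
  encodeEdges {n} G =
    List.map (λ (u , v) → toℕ u , toℕ v , weight u v)
      (filter (λ (u , v) → adj? u v) (cartesianProduct (allFin n) (allFin n)))
    where open WeightedGraph G

  encode : ∀ {n k} → WeightedGraph n → Carrier → Partition n k →
           {_⪯_ : Rel (Fin k) 0ℓ} → IsDecTotalOrder _≡_ _⪯_ → ℕ → Subset k →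
           Env Input
  encode {n} {k} G r 𝒫 ⪯-ord m A =
    n ∷ encodeEdges G ∷ r ∷
    k ∷ encodeRel (λ v X → Partition.part 𝒫 v ≟ X) ∷
    encodeRel (IsDecTotalOrder._≤?_ ⪯-ord) ∷ m ∷ indices A ∷ []

-- Call Y near X if Y is weakly r-reachable from X. A path of length at most r
-- between parts X₁ and X₂ passes through a vertex of its ⪯-least part Y, which
-- is therefore near both X₁ and X₂. So it suffices to find S and B such that
-- only members of S are near two members of B: a sunflower.
--
-- Let B be a greedily chosen maximal subfamily of A with this property, for the
-- current S. If |B| < m, every X ∈ A shares a near part outside S with a member
-- of B, so one of at most mc parts Y ∉ S is near a 1/(mc) fraction of A. Add
-- the best such Y to S, restrict A to the X ≠ Y that Y is near, and repeat.
-- Then S consists of parts near every member of A, and A is disjoint from S, so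
-- |S| < c as long as A is nonempty. Since A starts with at least (2mc)^(c+1)
-- members, it would survive c unsuccessful rounds; so some round succeeds.
--
-- The near parts are computed by the Bellman–Ford algorithm.
module Submission where

open import Defs
open import Data.Fin.Base using (Fin)
open import Data.Fin.Subset using (Subset; _∈_; _⊆_; _─_; ∁; ∣_∣)
open import Data.Nat.Base using (ℕ; NonZero; _+_; _*_; _^_; _≤_; _≥_)
open import Data.Product.Base using (∃; ∃₂; _×_; _,_)
open import Level using (0ℓ)
open import Relation.Binary.Core using (Rel)
open import Relation.Binary.PropositionalEquality.Core using (_≡_; _≢_)
open import Relation.Binary.Structures using (IsDecTotalOrder)
open import Relation.Nullary.Construct.Add.Supremum using ([_])

open import Algebra.Bundles using (CommutativeRing)
open import Data.Bool.Base using (Bool; true; false; if_then_else_)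
open import Data.Fin.Base using (zero; suc; toℕ)
open import Data.Fin.Properties using (_≟_; toℕ-injective; injective⇒≤)
open import Data.Fin.Subset using (_∉_; _-_; ⁅_⁆; inside; outside)
open import Data.Fin.Subset.Properties
  using (_∈?_; ∣p∣≤n; p⊆q⇒∣p∣≤∣q∣; p─q⊆p; p─q─q≡p─q; p─x─y≡p─y─x;
           x∈p∧x∉q⇒x∈p─q; x∈p∧x≢y⇒x∈p-y; x∈p⇒∣p-x∣<∣p∣; x∈∁p⇒x∉p)
open import Data.List.Base as List
  using (List; []; _∷_; _++_; allFin; cartesianProduct; concatMap; filter; foldr; length; map; tabulate)
import Data.List.Extrema
import Data.List.Extrema.Nat as Extremaℕ
import Data.List.Membership.DecPropositional as DecMem
import Data.List.Membership.Propositional as ListMem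
open import Data.List.Membership.Propositional.Properties
  using (∈-∃++; ∈-allFin; ∈-cartesianProduct⁺; ∈-cartesianProduct⁻; ∈-concatMap⁺;
           ∈-concatMap⁻; ∈-filter⁺; ∈-filter⁻; ∈-map⁺; ∈-map⁻)
open import Data.List.Properties
  using (filter-++; foldr-++; length-++; length-filter; length-map; length-tabulate; map-++; map-tabulate; map-∘)
open import Data.List.Relation.Binary.Sublist.Propositional as Sublist
  using ([]; _∷_; _∷ʳ_; ⊆-refl; ⊆-trans; minimum) renaming (_⊆_ to _⊑_; lookup to ⊑-lookup)
open import Data.List.Relation.Binary.Sublist.Propositional.Properties
  using (All-resp-⊆; filter-⊆; filter⁺; length-mono-≤) renaming (map⁺ to ⊑-map⁺)
import Data.List.Relation.Binary.Subset.Propositional as ListSub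
open import Data.List.Relation.Unary.All as All using (All; []; _∷_)
open import Data.List.Relation.Unary.All.Properties using (¬Any⇒All¬)
open import Data.List.Relation.Unary.AllPairs using (AllPairs; []; _∷_)
open import Data.List.Relation.Unary.Any as Any using (Any; here; there)
open import Data.List.Relation.Unary.Unique.Propositional using (Unique)
open import Data.List.Relation.Unary.Unique.Propositional.Properties
  using (allFin⁺) renaming (filter⁺ to unique-filter⁺; map⁺ to unique-map⁺)
open import Data.Maybe.Base as Maybe using (Maybe; from-just; just; nothing; zipWith)
open import Data.Nat.Base as ℕ using (zero; suc; _<_; z≤n; s≤s)
import Data.Nat.Properties as ℕ
open import Data.Product.Base as Product using (proj₁; proj₂)
open import Data.Product.Properties using (≡-dec)
open import Data.Sum.Base as Sum using (_⊎_; inj₁; inj₂)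
open import Data.Unit.Base using (⊤; tt)
open import Data.Vec.Base using ([]; _∷_)
open import Data.Vec.Properties using (lookup⇒[]=; []=⇒lookup; lookup∘tabulate)
open import Function.Base using (_∘_; id)
import Relation.Binary.Construct.Add.Supremum.Strict as AddSupStrict
open import Relation.Binary.Bundles using (Poset)
open import Relation.Binary.PropositionalEquality
  using (refl; sym; trans; cong; cong₂; subst; subst₂; module ≡-Reasoning)
open import Relation.Nullary.Construct.Add.Supremum using (_⁺; ⊤⁺)
open import Relation.Nullary.Decidable using (Dec; yes; no; does; proof; dec-true; ¬?)
open import Relation.Nullary.Negation using (¬_; contradiction)
open import Relation.Nullary.Reflects using (Reflects; ofʸ; ofⁿ)
open import Relation.Unary using (Pred; Decidable)
open import Relation.Unary.Properties using (∁?)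

-- The factor 2 in 2mc pays for the part `Y` itself, which is dropped from the next family if it
-- belongs to `A`: from 2x ≤ y + 1 and x ≥ 1 still follows x ≤ y. The program is never told c. It
-- runs one round per part and idles after the first success; the bound |S| < c occurs in the proof
-- only. The running time shapes the programs: every list is obtained by filtering or mapping a list
-- at hand, so none outgrows the longest input list, and the cost of a loop can be read off from its
-- syntax. Filtering also keeps the order, so the outputs are sublists of the list of parts and
-- hence literally of the form `indices`.

private variable
  α β : Set

-- Lists, sublists and subsets of a finite set.

∈-++-delete : ∀ {x y : α} xs {ys} → x ≢ y → x ListMem.∈ xs ++ y ∷ ys → x ListMem.∈ xs ++ ys
∈-++-delete []       x≢y (here x≡y)  = contradiction x≡y x≢y
∈-++-delete []       x≢y (there x∈)  = x∈
∈-++-delete (_ ∷ xs) x≢y (here refl) = here refl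
∈-++-delete (_ ∷ xs) x≢y (there x∈)  = there (∈-++-delete xs x≢y x∈)

unique-⊆⇒length≤ : {xs ys : List α} → Unique xs → xs ListSub.⊆ ys → length xs ≤ length ys
unique-⊆⇒length≤ []          _     = z≤n
unique-⊆⇒length≤ {xs = x ∷ xs} (x∉xs ∷ xs!) xs⊆ys
  with ys , zs , refl ← ∈-∃++ (xs⊆ys (here refl)) = begin
    suc (length xs)             ≤⟨ s≤s (unique-⊆⇒length≤ xs! xs⊆) ⟩
    suc (length (ys ++ zs))     ≡⟨ cong suc (length-++ ys) ⟩
    suc (length ys + length zs) ≡⟨ ℕ.+-suc (length ys) (length zs) ⟨
    length ys + suc (length zs) ≡⟨ length-++ ys ⟨
    length (ys ++ x ∷ zs)       ∎
  where
  open ℕ.≤-Reasoning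
  xs⊆ : xs ListSub.⊆ ys ++ zs
  xs⊆ z∈xs = ∈-++-delete ys (λ z≡x → All.lookup x∉xs z∈xs (sym z≡x)) (xs⊆ys (there z∈xs))

Unique-resp-⊒ : {xs ys : List α} → xs ⊑ ys → Unique ys → Unique xs
Unique-resp-⊒ []         []           = []
Unique-resp-⊒ (y ∷ʳ τ)   (_ ∷ ys!)    = Unique-resp-⊒ τ ys!
Unique-resp-⊒ (refl ∷ τ) (y∉ys ∷ ys!) = All-resp-⊆ τ y∉ys ∷ Unique-resp-⊒ τ ys!

length-filter-∁ : {P : Pred α 0ℓ} (P? : Decidable P) (xs : List α) →
                  length xs ≡ length (filter P? xs) + length (filter (∁? P?) xs)
length-filter-∁ P? []       = refl
length-filter-∁ P? (x ∷ xs) with P? x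
... | yes _ = cong suc (length-filter-∁ P? xs)
... | no _  = trans (cong suc (length-filter-∁ P? xs)) (sym (ℕ.+-suc _ _))

-- Each `y` is charged with the entries related to it, and the rest is passed on. The bound `ℓ` is
-- uniform, with no choice of a popular `y`, because the popular part is found by maximisation and
-- `ℓ` is read off from it.
pigeonhole : {R : α → β → Set} (R? : ∀ y → Decidable (λ x → R x y)) (xs : List α) (ys : List β) {ℓ : ℕ} →
             (∀ {x} → x ListMem.∈ xs → Any (R x) ys) →
             (∀ {y} → y ListMem.∈ ys → length (filter (R? y) xs) ≤ ℓ) →
             length xs ≤ length ys * ℓ
pigeonhole R? []       []       _     _     = z≤n
pigeonhole R? (x ∷ xs) []       cover _     with () ← cover (here refl)
pigeonhole {R = R} R? xs (y ∷ ys) {ℓ} cover small = begin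
  length xs                                                    ≡⟨ length-filter-∁ (R? y) xs ⟩
  length (filter (R? y) xs) + length (filter (∁? (R? y)) xs)   ≤⟨ ℕ.+-mono-≤ (small (here refl)) rest ⟩
  ℓ + length ys * ℓ                                            ∎
  where
  open ℕ.≤-Reasoning
  cover′ : ∀ {x} → x ListMem.∈ filter (∁? (R? y)) xs → Any (R x) ys
  cover′ x∈ with x∈xs , ¬Rxy ← ∈-filter⁻ (∁? (R? y)) x∈ with cover x∈xs
  ... | here Rxy = contradiction Rxy ¬Rxy
  ... | there Rx = Rx
  small′ : ∀ {z} → z ListMem.∈ ys → length (filter (R? z) (filter (∁? (R? y)) xs)) ≤ ℓ
  small′ {z} z∈ys = ℕ.≤-trans
    (length-mono-≤ (filter⁺ (R? z) (R? z) (λ { refl → id }) (filter-⊆ (∁? (R? y)) xs)))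
    (small (there z∈ys))
  rest = pigeonhole R? (filter (∁? (R? y)) xs) ys cover′ small′

-- `AllPairs` compares an entry only with later ones, so the orientation in which `R` holds depends
-- on the positions of `x` and `y`.
allPairs-total : {R : α → α → Set} {xs : List α} → AllPairs R xs → ∀ {x y} →
                 x ListMem.∈ xs → y ListMem.∈ xs → x ≢ y → R x y ⊎ R y x
allPairs-total (Rx ∷ _)   (here refl) (here refl) x≢y = contradiction refl x≢y
allPairs-total (Rx ∷ _)   (here refl) (there y∈)  _   = inj₁ (All.lookup Rx y∈)
allPairs-total (Ry ∷ _)   (there x∈)  (here refl) _   = inj₂ (All.lookup Ry x∈)
allPairs-total (_ ∷ Rxs)  (there x∈)  (there y∈)  x≢y = allPairs-total Rxs x∈ y∈ x≢y

elements-∷ : ∀ {n} s (p : Subset n) →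
  elements (s ∷ p) ≡ (if s then zero ∷ map suc (elements p) else map suc (elements p))
elements-∷ {n} s p = trans (head s) (cong (λ xs → if s then zero ∷ xs else xs) tail′)
  where
  head : ∀ s → elements (s ∷ p) ≡
    (if s then zero ∷ filter (_∈? (s ∷ p)) (tabulate suc) else filter (_∈? (s ∷ p)) (tabulate suc))
  head inside  = refl
  head outside = refl
  step : ∀ xs → filter (_∈? (s ∷ p)) (map suc xs) ≡ map suc (filter (_∈? p) xs)
  step []       = refl
  step (x ∷ xs) with x ∈? p
  ... | yes _ = cong (suc x ∷_) (step xs)
  ... | no _  = step xs
  tail′ : filter (_∈? (s ∷ p)) (tabulate suc) ≡ map suc (elements p)
  tail′ = trans (cong (filter (_∈? (s ∷ p))) (sym (map-tabulate id suc))) (step (allFin n))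

-- The output has to equal a list of indices on the nose. A sublist keeps order and multiplicity, so
-- it determines such a subset, which mere inclusion of members would not do.
sublist-indices : ∀ {n} {xs : List α} (f : Fin n → α) → xs ⊑ map f (allFin n) →
                  ∃ λ p → xs ≡ map f (elements p)
sublist-indices {n = zero}  f []  = [] , refl
sublist-indices {n = suc n} {xs} f τ
  with subst (λ ys → xs ⊑ f zero ∷ ys) (trans (map-tabulate suc f) (sym (map-tabulate id (f ∘ suc)))) τ
... | _ ∷ʳ τ′ with p , refl ← sublist-indices (f ∘ suc) τ′ =
  outside ∷ p , trans (map-∘ (elements p)) (cong (map f) (sym (elements-∷ outside p)))
... | refl ∷ τ′ with p , refl ← sublist-indices (f ∘ suc) τ′ =
  inside ∷ p , trans (cong (f zero ∷_) (map-∘ (elements p))) (cong (map f) (sym (elements-∷ inside p)))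

length-elements : ∀ {n} (p : Subset n) → length (elements p) ≡ ∣ p ∣
length-elements []            = refl
length-elements (s ∷ p) with elements (s ∷ p) | elements-∷ s p
length-elements (inside ∷ p)  | _ | refl = cong suc (trans (length-map suc (elements p)) (length-elements p))
length-elements (outside ∷ p) | _ | refl = trans (length-map suc (elements p)) (length-elements p)

∈-elements⁺ : ∀ {n} {p : Subset n} {i} → i ∈ p → i ListMem.∈ elements p
∈-elements⁺ {p = p} i∈p = ∈-filter⁺ (_∈? p) (∈-allFin _) i∈p

∈-elements⁻ : ∀ {n} {p : Subset n} {i} → i ListMem.∈ elements p → i ∈ p
∈-elements⁻ {p = p} i∈ = proj₂ (∈-filter⁻ (_∈? p) {xs = allFin _} i∈)

∈-comprehension⁺ : ∀ {n} {P : Pred (Fin n) 0ℓ} (P? : Decidable P) {i} → P i → i ∈ comprehension P?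
∈-comprehension⁺ P? {i} Pi = lookup⇒[]= i _ (trans (lookup∘tabulate (does ∘ P?) i) (dec-true (P? i) Pi))

∈-comprehension⁻ : ∀ {n} {P : Pred (Fin n) 0ℓ} (P? : Decidable P) {i} → i ∈ comprehension P? → P i
∈-comprehension⁻ P? {i} i∈ with P? i | trans (sym (lookup∘tabulate (does ∘ P?) i)) ([]=⇒lookup i∈)
... | yes Pi | _ = Pi

-- Boolean tests, and folds that decide, filter and select.

reflects-map : {α β : Set} {b : Bool} → (α → β) → (β → α) → Reflects α b → Reflects β b
reflects-map f g (ofʸ a)  = ofʸ (f a)
reflects-map f g (ofⁿ ¬a) = ofⁿ (¬a ∘ g)

and-reflects : {α β : Set} {a b : Bool} → Reflects α a → Reflects β b → Reflects (α × β) (if a then b else false)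
and-reflects (ofʸ a)  (ofʸ b)  = ofʸ (a , b)
and-reflects (ofʸ a)  (ofⁿ ¬b) = ofⁿ (¬b ∘ proj₂)
and-reflects (ofⁿ ¬a) _        = ofⁿ (¬a ∘ proj₁)

or-reflects : {α β : Set} {a b : Bool} → Reflects α a → Reflects β b → Reflects (α ⊎ β) (if a then true else b)
or-reflects (ofʸ a)  _        = ofʸ (inj₁ a)
or-reflects (ofⁿ ¬a) (ofʸ b)  = ofʸ (inj₂ b)
or-reflects (ofⁿ ¬a) (ofⁿ ¬b) = ofⁿ Sum.[ ¬a , ¬b ]

not-reflects : {α : Set} {a : Bool} → Reflects α a → Reflects (¬ α) (if a then false else true)
not-reflects (ofʸ a)  = ofⁿ (λ ¬a → ¬a a)
not-reflects (ofⁿ ¬a) = ofʸ ¬a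

-- The body of the program `some` has the accumulator in scope, so the test takes it as an argument,
-- although the proposition decided does not depend on it.
some-reflects : {P : Pred α 0ℓ} {p : α → Bool → Bool} → (∀ x b → Reflects (P x) (p x b)) → ∀ xs →
                Reflects (Any P xs) (foldr (λ x b → if p x b then true else b) false xs)
some-reflects r []       = ofⁿ λ ()
some-reflects {p = p} r (x ∷ xs) with foldr (λ x b → if p x b then true else b) false xs
  | some-reflects {p = p} r xs
... | b | ih  with p x b | r x b
... | _ | ofʸ Px = reflects-map (λ _ → here Px) (λ _ → Px) (ofʸ Px)
... | _ | ofⁿ ¬Px = reflects-map there (Any.tail ¬Px) ih

infix 7 _≡ᵇ_

-- The value of the program `_=ₙ_`; the language compares naturals by ≤ only.
_≡ᵇ_ : ℕ → ℕ → Bool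
m ≡ᵇ n = if does (m ℕ.≤? n) then does (n ℕ.≤? m) else false

=-reflects : ∀ m n → Reflects (m ≡ n) (m ≡ᵇ n)
=-reflects m n = reflects-map (λ (m≤n , n≤m) → ℕ.≤-antisym m≤n n≤m) (λ { refl → ℕ.≤-refl , ℕ.≤-refl })
  (and-reflects (proof (m ℕ.≤? n)) (proof (n ℕ.≤? m)))

-- The value of the program `collect`. The test may consult the entries collected so far, and the
-- greedy choice relies on this.
collecting : (α → List β → Bool) → (α → List β → β) → List α → List β
collecting p f = foldr (λ x ys → if p x ys then f x ys ∷ ys else ys) []

module _ {P : Pred α 0ℓ} {p : α → List β → Bool} {f : α → List β → β} (r : ∀ x ys → Reflects (P x) (p x ys)) where

  ∈-collecting⁺ : ∀ {x xs} → x ListMem.∈ xs → P x → ∃ λ ys → f x ys ListMem.∈ collecting p f xs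
  ∈-collecting⁺ {xs = x ∷ xs} (here refl) Px with p x (collecting p f xs) | r x (collecting p f xs)
  ... | _ | ofʸ _  = _ , here refl
  ... | _ | ofⁿ ¬P = contradiction Px ¬P
  ∈-collecting⁺ {xs = x ∷ xs} (there x∈) Px with p x (collecting p f xs)
  ... | true  = Product.map₂ there (∈-collecting⁺ x∈ Px)
  ... | false = ∈-collecting⁺ x∈ Px

  ∈-collecting⁻ : ∀ {y} xs → y ListMem.∈ collecting p f xs →
                  ∃₂ λ x ys → x ListMem.∈ xs × P x × y ≡ f x ys
  ∈-collecting⁻ (x ∷ xs) y∈ with p x (collecting p f xs) | r x (collecting p f xs)
  ∈-collecting⁻ (x ∷ xs) (here refl) | _ | ofʸ Px = x , _ , here refl , Px , refl
  ∈-collecting⁻ (x ∷ xs) (there y∈)  | _ | ofʸ Px =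
    let _ , _ , x∈ , rest = ∈-collecting⁻ xs y∈ in _ , _ , there x∈ , rest
  ∈-collecting⁻ (x ∷ xs) y∈          | _ | ofⁿ _  =
    let _ , _ , x∈ , rest = ∈-collecting⁻ xs y∈ in _ , _ , there x∈ , rest

selecting : (α → List α → Bool) → List α → List α
selecting p = collecting p (λ x _ → x)

selecting-⊑ : (p : α → List α → Bool) (xs : List α) → selecting p xs ⊑ xs
selecting-⊑ p []       = []
selecting-⊑ p (x ∷ xs) with p x (selecting p xs)
... | true  = refl ∷ selecting-⊑ p xs
... | false = x ∷ʳ selecting-⊑ p xs

module _ {R : α → α → Set} {p : α → List α → Bool} (r : ∀ x ys → Reflects (Any (R x) ys) (p x ys)) where

  private
    p̅ : α → List α → Bool
    p̅ x ys = if p x ys then false else true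

  selecting-allPairs : ∀ xs → AllPairs (λ x y → ¬ R x y) (selecting p̅ xs)
  selecting-allPairs []       = []
  selecting-allPairs (x ∷ xs) with p x (selecting p̅ xs) | r x (selecting p̅ xs)
  ... | _ | ofⁿ ¬Rx = All.tabulate (λ y∈ Rxy → ¬Rx (ListMem.lose y∈ Rxy)) ∷ selecting-allPairs xs
  ... | _ | ofʸ _   = selecting-allPairs xs

  -- The fold runs from the end of the list. A rejected entry is related to one chosen before it,
  -- and a chosen entry is never dropped.
  selecting-maximal : ∀ {x} xs → x ListMem.∈ xs → x ListMem.∈ selecting p̅ xs ⊎ Any (R x) (selecting p̅ xs)
  selecting-maximal (x ∷ xs) x∈ with p x (selecting p̅ xs) | r x (selecting p̅ xs)
  selecting-maximal (x ∷ xs) (here refl) | _ | ofⁿ _  = inj₁ (here refl)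
  selecting-maximal (x ∷ xs) (there x∈)  | _ | ofⁿ _  = Sum.map there there (selecting-maximal xs x∈)
  selecting-maximal (x ∷ xs) (here refl) | _ | ofʸ Rx = inj₂ Rx
  selecting-maximal (x ∷ xs) (there x∈)  | _ | ofʸ _  = selecting-maximal xs x∈

-- Invariants of folds.

foldr-preserves : {f : α → β → β} {b : β} (Q : β → Set) → ∀ xs → Q b →
                  (∀ {x y} → x ListMem.∈ xs → Q y → Q (f x y)) → Q (foldr f b xs)
foldr-preserves Q []       Qb step = Qb
foldr-preserves Q (x ∷ xs) Qb step = step (here refl) (foldr-preserves Q xs Qb (step ∘ there))

foldr-attains : {f : α → β → β} {b : β} (Q : β → Set) → ∀ {x xs} → x ListMem.∈ xs →
                (∀ {y} → Q (f x y)) → (∀ {z y} → Q y → Q (f z y)) → Q (foldr f b xs)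
foldr-attains Q (here refl) attain keep = attain
foldr-attains Q (there x∈)  attain keep = keep (foldr-attains Q x∈ attain keep)

-- The list serves only as a loop counter.
foldr-counts : {f : β → β} {b : β} (Q : ℕ → β → Set) (xs : List α) → Q 0 b →
               (∀ {i y} → Q i y → Q (suc i) (f y)) → Q (length xs) (foldr (λ _ → f) b xs)
foldr-counts Q []       Qb step = Qb
foldr-counts Q (x ∷ xs) Qb step = step (foldr-counts Q xs Qb step)

-- Running time

module Cost (ℝ : Reals) where
  open Semantics ℝ

  -- Only lengths of lists count: arithmetic has unit cost, and a number could prolong a loop only
  -- through `iter`, which the analysed programs avoid.
  Small : ℕ → ∀ A → ⟦ A ⟧ → Set
  Small N nat      _        = ⊤
  Small N real     _        = ⊤
  Small N bool     _        = ⊤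
  Small N (list A) xs       = length xs ≤ N × All (Small N A) xs
  Small N (A ⊗ B)  (x , y)  = Small N A x × Small N B y

  SmallEnv : ∀ {Γ} → ℕ → Env Γ → Set
  SmallEnv {Γ} N ρ = ∀ {A} (x : A ListMem.∈ Γ) → Small N A (All.lookup ρ x)

  infixr 5 _∷ˢ_

  _∷ˢ_ : ∀ {Γ N A} {a : ⟦ A ⟧} {ρ : Env Γ} → Small N A a → SmallEnv N ρ → SmallEnv N (_∷_ {x = A} a ρ)
  (a ∷ˢ ρ) (here refl) = a
  (a ∷ˢ ρ) (there x)   = ρ x

  -- The same number s serves as coefficient and as exponent, so that s can be
  -- the size of a program.
  record Within (N s c : ℕ) : Set where
    constructor ⟪_⟫
    field bound : c ≤ s * N ^ s

  module _ {N} .{{_ : NonZero N}} where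

    within-mono : ∀ {s t c} → s ≤ t → Within N s c → Within N t c
    within-mono s≤t ⟪ c≤ ⟫ = ⟪ ℕ.≤-trans c≤ (ℕ.*-mono-≤ s≤t (ℕ.^-monoʳ-≤ N s≤t)) ⟫

    within-one : Within N 1 1
    within-one = ⟪ ℕ.≤-trans (ℕ.n≢0⇒n>0 (ℕ.≢-nonZero⁻¹ N))
      (ℕ.≤-reflexive (sym (trans (ℕ.*-identityˡ _) (ℕ.*-identityʳ N)))) ⟫

    within-suc+ : ∀ {s t c d} → Within N s c → Within N t d → Within N (suc (s + t)) (suc (c + d))
    within-suc+ {s} {t} {c} {d} ⟪ c≤ ⟫ ⟪ d≤ ⟫ = ⟪ begin
      suc (c + d)                                            ≤⟨ ℕ.+-mono-≤ (ℕ.m^n>0 N u) (ℕ.+-mono-≤ c≤ d≤) ⟩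
      N ^ u + (s * N ^ s + t * N ^ t)                        ≤⟨ ℕ.+-monoʳ-≤ (N ^ u) (ℕ.+-mono-≤
        (ℕ.*-monoʳ-≤ s (ℕ.^-monoʳ-≤ N (ℕ.m≤n⇒m≤1+n (ℕ.m≤m+n s t))))
        (ℕ.*-monoʳ-≤ t (ℕ.^-monoʳ-≤ N (ℕ.m≤n⇒m≤1+n (ℕ.m≤n+m t s))))) ⟩
      N ^ u + (s * N ^ u + t * N ^ u)                        ≡⟨ cong (N ^ u +_) (ℕ.*-distribʳ-+ (N ^ u) s t) ⟨
      u * N ^ u                                              ∎ ⟫
      where
      open ℕ.≤-Reasoning
      u = suc (s + t)

    within-suc : ∀ {s c} → Within N s c → Within N (suc s) (suc c)
    within-suc {s} {c} c≤ = subst₂ (Within N)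
      (cong suc (ℕ.+-identityʳ s)) (cong suc (ℕ.+-identityʳ c))
      (within-suc+ c≤ (⟪_⟫ {s = 0} z≤n))

    within-if : ∀ {s t c d} b → Within N s c → Within N t d → Within N (s + t) (if b then c else d)
    within-if {s} {t} true  c≤ d≤ = within-mono (ℕ.m≤m+n s t) c≤
    within-if {s} {t} false c≤ d≤ = within-mono (ℕ.m≤n+m t s) d≤

    -- At most `N` rounds cost one more factor `N`; the unit charged per round goes into the
    -- coefficient.
    within-loop : ∀ {s c ℓ} → ℓ ≤ N → c ≤ ℓ * suc (s * N ^ s) → Within N (suc s) c
    within-loop {s} {c} {ℓ} ℓ≤N c≤ = ⟪ begin
      c                            ≤⟨ c≤ ⟩
      ℓ * suc (s * N ^ s)          ≤⟨ ℕ.*-mono-≤ ℓ≤N (ℕ.+-monoˡ-≤ (s * N ^ s) (ℕ.m^n>0 N s)) ⟩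
      N * (suc s * N ^ s)          ≡⟨ ℕ.*-assoc N (suc s) (N ^ s) ⟨
      N * suc s * N ^ s            ≡⟨ cong (_* N ^ s) (ℕ.*-comm N (suc s)) ⟩
      suc s * N * N ^ s            ≡⟨ ℕ.*-assoc (suc s) N (N ^ s) ⟩
      suc s * N ^ suc s            ∎ ⟫
      where open ℕ.≤-Reasoning

    within-fold : ∀ {s t u c d e} → Within N s c → Within N t d → Within N u e →
                  Within N (suc (suc (s + t) + u)) (suc (c + d + e))
    within-fold c≤ d≤ e≤ with ⟪ bound ⟫ ← within-suc+ (within-suc+ c≤ d≤) e≤ = ⟪ ℕ.≤-trans (ℕ.n≤1+n _) bound ⟫

  -- Cost and invariant are treated together, since a round is known to be cheap only while the
  -- invariant holds. The index counts the entries processed, for accumulators that grow by at most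
  -- one per round.
  foldCost-≤ : {A B : Set} {P : A → Set} (I : ℕ → B → Set) {f : A → B → B} {κ : A → B → ℕ} {b : B} {K : ℕ}
    (as : List A) → All P as → I 0 b →
    (∀ {i a b} → i < length as → P a → I i b → κ a b ≤ K × I (suc i) (f a b)) →
    foldCost f κ b as ≤ length as * suc K × I (length as) (foldr f b as)
  foldCost-≤ I []       []        Ib step = z≤n , Ib
  foldCost-≤ I (a ∷ as) (Pa ∷ Ps) Ib step
    with c≤ , Ic ← foldCost-≤ I as Ps Ib (λ i< → step (ℕ.m<n⇒m<1+n i<))
    with κ≤ , If ← step ℕ.≤-refl Pa Ic = ℕ.+-mono-≤ (s≤s κ≤) c≤ , If

  -- The same `N` bounds the environment and the value. Therefore bounds compose by adding the
  -- numbers `s`, and no polynomial is ever substituted into another.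
  Polynomial : ∀ {Γ A} → Program Γ A → Set
  Polynomial {Γ} {A} t = ∃ λ s → ∀ {N} .{{_ : NonZero N}} (ρ : Env Γ) → SmallEnv N ρ →
    Within N s (cost t ρ) × Small N A (value t ρ)

  module _ {Γ : Ctx} where

    poly-let : ∀ {A B} {s : Program Γ A} {t : Program (A ∷ Γ) B} →
               Polynomial s → Polynomial t → Polynomial (let′ s t)
    poly-let (s , ps) (t , pt) = _ , λ ρ ρˢ →
      let c≤ , v = ps ρ ρˢ
          d≤ , w = pt _ (v ∷ˢ ρˢ)
      in within-suc+ c≤ d≤ , w

    poly-if : ∀ {A} {b : Program Γ bool} {s t : Program Γ A} →
              Polynomial b → Polynomial s → Polynomial t → Polynomial (if b s t)
    poly-if {A} {b} {s} {t} (nb , pb) (ns , ps) (nt , pt) = _ , λ ρ ρˢ →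
      let c≤ , v = ps ρ ρˢ
          d≤ , w = pt ρ ρˢ
      in within-suc+ (proj₁ (pb ρ ρˢ)) (within-if (value b ρ) c≤ d≤)
       , small (value b ρ) v w
      where
      small : ∀ {N x y} β → Small N A x → Small N A y → Small N A (if β then x else y)
      small true  v w = v
      small false v w = w

    poly-fold : ∀ {A B} {l : Program Γ (list A)} {s : Program Γ B} {t : Program (A ∷ B ∷ Γ) B} →
                Polynomial l → Polynomial s → Polynomial t → Polynomial (fold l s t)
    poly-fold {A} {B} {l} (nl , pl) (ns , ps) (nt , pt) = _ , λ {N} ρ ρˢ →
      let c≤ , ℓ≤ , as = pl ρ ρˢ
          d≤ , b = ps ρ ρˢ
          e≤ , r = foldCost-≤ (λ _ → Small N B) (value l ρ) as b
                   (λ _ a b → let κ≤ , r = pt {N} _ (a ∷ˢ b ∷ˢ ρˢ) in Within.bound κ≤ , r)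
      in within-fold c≤ d≤ (within-loop {s = nt} ℓ≤ e≤) , r

    -- The accumulator of such a fold is never longer than the list folded over.
    poly-collect : ∀ {A B} {l : Program Γ (list A)}
                   {b : Program (A ∷ list B ∷ Γ) bool}
                   {h : Program (A ∷ list B ∷ Γ) B} →
                   Polynomial l → Polynomial b → Polynomial h →
                   Polynomial (fold l nil (if b (cons h (var (there (here refl)))) (var (there (here refl)))))
    poly-collect {A} {B} {l} {b} {h} (nl , pl) (nb , pb) (nh , ph) = _ , λ {N} ρ ρˢ →
      let c≤ , ℓ≤ , as = pl ρ ρˢ
          e≤ , len , r = foldCost-≤ (λ i bs → length bs ≤ i × All (Small N B) bs) (value l ρ) as (z≤n , [])
            (λ {i} {a} {bs} i< aˢ (len , bsˢ) →
               let ρ′ˢ = aˢ ∷ˢ (ℕ.≤-trans len (ℕ.≤-trans (ℕ.<⇒≤ i<) ℓ≤) , bsˢ) ∷ˢ ρˢ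
                   cb , _ = pb (a ∷ bs ∷ ρ) ρ′ˢ
                   ch , v = ph (a ∷ bs ∷ ρ) ρ′ˢ
               in Within.bound (within-suc+ cb
                    (within-if (value b (a ∷ bs ∷ ρ)) (within-suc+ ch within-one) within-one))
                , small (value b (a ∷ bs ∷ ρ)) v len bsˢ)
      in within-fold c≤ within-one
           (within-loop {s = suc (nb + (suc (nh + 1) + 1))} ℓ≤ e≤)
       , ℕ.≤-trans len ℓ≤ , r
      where
      small : ∀ {N i x xs} β → Small N B x → length xs ≤ i → All (Small N B) xs →
              let ys = if β then x ∷ xs else xs in length ys ≤ suc i × All (Small N B) ys
      small true  v len vs = s≤s len , v ∷ vs
      small false v len vs = ℕ.m≤n⇒m≤1+n len , vs

  -- Programs with `iter` or `match`, or that build lists otherwise than by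
  -- filtering and mapping, are not analysed.
  polynomial? : ∀ {Γ A} (t : Program Γ A) → Maybe (Polynomial t)
  polynomial? (var x)       = just (1 , λ ρ ρˢ → within-one , ρˢ x)
  polynomial? (let′ s t)    = zipWith poly-let (polynomial? s) (polynomial? t)
  polynomial? true          = just (1 , λ ρ ρˢ → within-one , tt)
  polynomial? false         = just (1 , λ ρ ρˢ → within-one , tt)
  polynomial? (if b s t)    = zipWith (λ p (q , r) → poly-if p q r) (polynomial? b)
                                (zipWith _,_ (polynomial? s) (polynomial? t))
  polynomial? zero          = just (1 , λ ρ ρˢ → within-one , tt)
  polynomial? (suc t) = Maybe.map
    (λ (_ , p) → _ , λ ρ ρˢ → within-suc (proj₁ (p ρ ρˢ)) , tt)
    (polynomial? t)
  polynomial? (s +ₙ t)      = nothing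
  polynomial? (s ≤ₙ t) = zipWith
    (λ (_ , p) (_ , q) → _ , λ ρ ρˢ → within-suc+ (proj₁ (p ρ ρˢ)) (proj₁ (q ρ ρˢ)) , tt)
    (polynomial? s) (polynomial? t)
  polynomial? (iter l s t)  = nothing
  polynomial? 0ᵣ            = just (1 , λ ρ ρˢ → within-one , tt)
  polynomial? (s +ᵣ t) = zipWith
    (λ (_ , p) (_ , q) → _ , λ ρ ρˢ → within-suc+ (proj₁ (p ρ ρˢ)) (proj₁ (q ρ ρˢ)) , tt)
    (polynomial? s) (polynomial? t)
  polynomial? (s ≤ᵣ t) = zipWith
    (λ (_ , p) (_ , q) → _ , λ ρ ρˢ → within-suc+ (proj₁ (p ρ ρˢ)) (proj₁ (q ρ ρˢ)) , tt)
    (polynomial? s) (polynomial? t)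
  polynomial? (pair s t) = zipWith
    (λ (_ , p) (_ , q) → _ , λ ρ ρˢ → within-suc+ (proj₁ (p ρ ρˢ)) (proj₁ (q ρ ρˢ))
       , proj₂ (p ρ ρˢ) , proj₂ (q ρ ρˢ))
    (polynomial? s) (polynomial? t)
  polynomial? (fst t) = Maybe.map
    (λ (_ , p) → _ , λ ρ ρˢ → within-suc (proj₁ (p ρ ρˢ)) , proj₁ (proj₂ (p ρ ρˢ)))
    (polynomial? t)
  polynomial? (snd t) = Maybe.map
    (λ (_ , p) → _ , λ ρ ρˢ → within-suc (proj₁ (p ρ ρˢ)) , proj₂ (proj₂ (p ρ ρˢ)))
    (polynomial? t)
  polynomial? nil           = just (1 , λ ρ ρˢ → within-one , z≤n , [])
  polynomial? (cons s t)    = nothing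
  polynomial? (match l s t) = nothing
  -- This clause has to precede the general one, which would analyse the body by itself and fail at
  -- its `cons`.
  polynomial? (fold l nil (if b (cons h (var (there (here refl)))) (var (there (here refl))))) =
    zipWith (λ p (q , r) → poly-collect p q r) (polynomial? l) (zipWith _,_ (polynomial? b) (polynomial? h))
  polynomial? (fold l s t) =
    zipWith (λ p (q , r) → poly-fold p q r) (polynomial? l) (zipWith _,_ (polynomial? s) (polynomial? t))

-- The algorithm

-- Subprograms are parametrised by variables of the surrounding context, which
-- are shifted under binders: then no weakening of programs is needed, and the
-- value of a subprogram unfolds in every environment. The variables hold
--   E  the edges,  P  the (vertex, part) pairs,  L  the order ⪯,
--   D  a table of tentative distances from the vertices to the part Y,
--   W  the pairs (y , x) with y weakly reachable from x,  K  the list of parts.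
_∋_ : Ctx → Ty → Set
Γ ∋ A = A ListMem.∈ Γ

private variable
  Γ : Ctx
  τ τ₁ τ₂ τ₃ τ₄ τ₅ : Ty

↑1 : Γ ∋ τ → (τ₁ ∷ Γ) ∋ τ
↑1 x = there x
↑2 : Γ ∋ τ → (τ₁ ∷ τ₂ ∷ Γ) ∋ τ
↑2 x = there (there x)
↑3 : Γ ∋ τ → (τ₁ ∷ τ₂ ∷ τ₃ ∷ Γ) ∋ τ
↑3 x = there (there (there x))
↑4 : Γ ∋ τ → (τ₁ ∷ τ₂ ∷ τ₃ ∷ τ₄ ∷ Γ) ∋ τ
↑4 x = there (there (there (there x)))
↑5 : Γ ∋ τ → (τ₁ ∷ τ₂ ∷ τ₃ ∷ τ₄ ∷ τ₅ ∷ Γ) ∋ τ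
↑5 x = there (there (there (there (there x))))

x₀ : (τ ∷ Γ) ∋ τ
x₀ = here refl
x₁ : (τ₁ ∷ τ ∷ Γ) ∋ τ
x₁ = there (here refl)
x₂ : (τ₁ ∷ τ₂ ∷ τ ∷ Γ) ∋ τ
x₂ = there (there (here refl))
x₃ : (τ₁ ∷ τ₂ ∷ τ₃ ∷ τ ∷ Γ) ∋ τ
x₃ = there (there (there (here refl)))

infixr 5 _or_
infixr 6 _and_
infix  7 _=ₙ_

not : Program Γ bool → Program Γ bool
not b = if b false true

_and_ _or_ : Program Γ bool → Program Γ bool → Program Γ bool
a and b = if a b false
a or b  = if a true b

_=ₙ_ : Program Γ nat → Program Γ nat → Program Γ bool
s =ₙ t = (s ≤ₙ t) and (t ≤ₙ s)

minᵣ : Program Γ real → Program Γ real → Program Γ real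
minᵣ s t = if (s ≤ᵣ t) s t

some : Program Γ (list τ) → Program (τ ∷ bool ∷ Γ) bool → Program Γ bool
some l b = fold l false (if b true (var x₁))

collect : Program Γ (list τ) → Program (τ ∷ list τ₁ ∷ Γ) bool →
          Program (τ ∷ list τ₁ ∷ Γ) τ₁ → Program Γ (list τ₁)
collect l b h = fold l nil (if b (cons h (var x₁)) (var x₁))

select : Program Γ (list τ) → Program (τ ∷ list τ ∷ Γ) bool → Program Γ (list τ)
select l b = collect l b (var x₀)

size : Program Γ (list τ) → Program Γ nat
size l = fold l zero (suc (var x₁))

member : Γ ∋ nat → Γ ∋ list nat → Program Γ bool
member x l = some (var l) (var (↑2 x) =ₙ var x₀)

related : Γ ∋ nat → Γ ∋ nat → Γ ∋ list (nat ⊗ nat) → Program Γ bool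
related x y R = some (var R) (fst (var x₀) =ₙ var (↑2 x) and snd (var x₀) =ₙ var (↑2 y))

-- One synchronous round: all new entries are computed from the old table `D`. Since edges are
-- listed in both directions, matching the first endpoint suffices.
relax : Γ ∋ list (nat ⊗ nat ⊗ real) → Γ ∋ list (nat ⊗ real) → Program Γ (list (nat ⊗ real))
relax E D = collect (var D) true (pair (fst (var x₀))
  (fold (var (↑2 E)) (snd (var x₀))
    (if (fst (var x₀) =ₙ fst (var x₂))
      (fold (var (↑4 D)) (var x₁)
        (if (fst (var x₀) =ₙ fst (snd (var x₂)))
          (minᵣ (snd (snd (var x₂)) +ᵣ snd (var x₀)) (var x₁))
          (var x₁)))
      (var x₁))))

-- One entry for each vertex that may be used on a path to Y; r + r stands for +∞.
initial : (Y : Γ ∋ nat) (r : Γ ∋ real) (P L : Γ ∋ list (nat ⊗ nat)) → Program Γ (list (nat ⊗ real))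
initial Y r P L = collect (var P) (let′ (snd (var x₀)) (related (↑3 Y) x₀ (↑3 L)))
  (pair (fst (var x₀)) (if (snd (var x₀) =ₙ var (↑2 Y)) 0ᵣ (var (↑2 r) +ᵣ var (↑2 r))))

-- `P` is the counter: it has an entry for each vertex, and a path needs no more rounds than it has
-- vertices.
distances : (Y : Γ ∋ nat) (E : Γ ∋ list (nat ⊗ nat ⊗ real)) (r : Γ ∋ real) (P L : Γ ∋ list (nat ⊗ nat)) →
            Program Γ (list (nat ⊗ real))
distances Y E r P L = fold (var P) (initial Y r P L) (relax (↑2 E) x₁)

reaches : (Y : Γ ∋ nat) (E : Γ ∋ list (nat ⊗ nat ⊗ real)) (r : Γ ∋ real) (P L : Γ ∋ list (nat ⊗ nat)) →
          (X : Γ ∋ nat) → Program Γ bool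
reaches Y E r P L X = let′ (distances Y E r P L)
  (some (var (↑1 P)) (snd (var x₀) =ₙ var (↑3 X) and
    some (var x₂) (fst (var x₀) =ₙ fst (var x₂) and (snd (var x₀) ≤ᵣ var (↑5 r)))))

-- `Y` is weakly reachable from `X` only if `Y ⪯ X`, so filtering the order loses no pair.
reachability : Γ ∋ list (nat ⊗ nat ⊗ real) → Γ ∋ real → (P L : Γ ∋ list (nat ⊗ nat)) →
               Program Γ (list (nat ⊗ nat))
reachability E r P L = select (var L)
  (let′ (fst (var x₀)) (let′ (snd (var x₁)) (reaches x₁ (↑4 E) (↑4 r) (↑4 P) (↑4 L) x₀)))

-- Since ⪯ is reflexive, its diagonal lists the parts.
diagonal : Γ ∋ list (nat ⊗ nat) → Program Γ (list nat)
diagonal L = collect (var L) (fst (var x₀) =ₙ snd (var x₀)) (fst (var x₀))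

conflict : (W : Γ ∋ list (nat ⊗ nat)) (S : Γ ∋ list nat) (a x : Γ ∋ nat) → Program Γ bool
conflict W S a x = some (var W) (snd (var x₀) =ₙ var (↑2 a) and
  let′ (fst (var x₀)) (not (member x₀ (↑3 S)) and related x₀ (↑3 x) (↑3 W)))

greedy : (W : Γ ∋ list (nat ⊗ nat)) (S A : Γ ∋ list nat) → Program Γ (list nat)
greedy W S A = select (var A) (not (some (var x₁) (conflict (↑4 W) (↑4 S) x₂ x₀)))

refine : (W : Γ ∋ list (nat ⊗ nat)) (A : Γ ∋ list nat) (y : Γ ∋ nat) → Program Γ (list nat)
refine W A y = select (var A) (not (var x₀ =ₙ var (↑2 y)) and related (↑2 y) x₀ (↑2 W))

better : (W : Γ ∋ list (nat ⊗ nat)) (S A : Γ ∋ list nat) (y : Γ ∋ nat) (s : Γ ∋ (nat ⊗ list nat)) →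
         Program Γ (nat ⊗ list nat)
better W S A y s = let′ (refine W A y)
  (if (not (member (↑1 y) (↑1 S)) and (size (snd (var (↑1 s))) ≤ₙ size (var x₀)))
    (pair (var (↑1 y)) (var x₀))
    (var (↑1 s)))

-- The initial pair is a placeholder and 0 is no candidate; as ties are won by the newcomer, the
-- first part outside `S` replaces it.
best : (W : Γ ∋ list (nat ⊗ nat)) (K S A : Γ ∋ list nat) → Program Γ (nat ⊗ list nat)
best W K S A = fold (var K) (pair zero nil) (better (↑2 W) (↑2 S) (↑2 A) x₀ x₁)

-- A filter of `K` instead of a `cons`: the result is again a sublist of `K`, and the cost analysis
-- applies.
insert : (K S : Γ ∋ list nat) → Γ ∋ nat → Program Γ (list nat)
insert K S y = select (var K) (var x₀ =ₙ var (↑2 y) or member x₀ (↑2 S))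

advance : (W : Γ ∋ list (nat ⊗ nat)) (K S A : Γ ∋ list nat) → Program Γ (list nat ⊗ list nat)
advance W K S A = let′ (best W K S A) (let′ (fst (var x₀)) (pair (insert (↑2 K) (↑2 S) x₀) (snd (var x₁))))

improve : (W : Γ ∋ list (nat ⊗ nat)) (K : Γ ∋ list nat) (m : Γ ∋ nat) (S A : Γ ∋ list nat) →
          Program Γ (list nat ⊗ list nat)
improve W K m S A = if (var m ≤ₙ size (greedy W S A)) (pair (var S) (var A)) (advance W K S A)

-- The fold over `K` only counts rounds. Their number replaces c, which the program does not
-- compute; a finished pair is left as it is.
search : (W : Γ ∋ list (nat ⊗ nat)) (K A : Γ ∋ list nat) (m : Γ ∋ nat) → Program Γ (list nat ⊗ list nat)
search W K A m = fold (var K) (pair nil (var A))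
  (let′ (fst (var x₁)) (let′ (snd (var x₂)) (improve (↑4 W) (↑4 K) (↑4 m) x₁ x₀)))

solve : (W : Γ ∋ list (nat ⊗ nat)) (K A : Γ ∋ list nat) (m : Γ ∋ nat) → Program Γ (list nat ⊗ list nat)
solve W K A m = let′ (search W K A m)
  (let′ (fst (var x₀)) (let′ (snd (var x₁)) (pair (var x₁) (greedy (↑3 W) x₁ x₀))))

algorithm : Program Input (list nat ⊗ list nat)
algorithm =
  let′ (reachability x₁ x₂ (there x₃) (↑5 x₀))
    (let′ (diagonal (↑5 x₁)) (solve x₁ x₀ (↑5 (↑4 x₀)) (↑5 x₃)))

-- What the tests of the algorithm decide.

module Spec (ℝ : Reals) where
  open Reals ℝ using (_≤?_) renaming (_≤_ to _≤ʳ_)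
  open Semantics ℝ

  module _ {Γ : Ctx} (ρ : Env Γ) where

    _! : ∀ {A} → Γ ∋ A → ⟦ A ⟧
    x ! = All.lookup ρ x

    member-reflects : ∀ x l → Reflects (x ! ListMem.∈ l !) (value (member x l) ρ)
    member-reflects x l = some-reflects (λ y _ → =-reflects (x !) y) (l !)

    related-reflects : ∀ x y R → Reflects ((x ! , y !) ListMem.∈ R !) (value (related x y R) ρ)
    related-reflects x y R = some-reflects
      (λ (u , v) _ → reflects-map (λ { (refl , refl) → refl }) (λ { refl → refl , refl })
        (and-reflects (=-reflects u (x !)) (=-reflects v (y !)))) (R !)

    size-length : ∀ {A} (l : Program Γ (list A)) → value (size l) ρ ≡ length (value l ρ)
    size-length l = go (value l ρ)
      where
      go : ∀ xs → foldr (λ _ n → suc n) 0 xs ≡ length xs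
      go []       = refl
      go (x ∷ xs) = cong suc (go xs)

  record Conflict (W : List (ℕ × ℕ)) (S : List ℕ) (a x : ℕ) : Set where
    constructor clash
    field
      {y} : ℕ
      a∈  : (y , a) ListMem.∈ W
      y∉S : ¬ (y ListMem.∈ S)
      x∈  : (y , x) ListMem.∈ W

  conflict-reflects : ∀ {Γ} (ρ : Env Γ) W S a x →
    Reflects (Conflict (All.lookup ρ W) (All.lookup ρ S) (All.lookup ρ a) (All.lookup ρ x))
      (value (conflict W S a x) ρ)
  conflict-reflects ρ W S a x = reflects-map to from (some-reflects test (All.lookup ρ W))
    where
    Shared : ℕ × ℕ → Set
    Shared (y , z) = z ≡ All.lookup ρ a × ¬ (y ListMem.∈ All.lookup ρ S)
      × (y , All.lookup ρ x) ListMem.∈ All.lookup ρ W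
    to : Any Shared (All.lookup ρ W) → Conflict (All.lookup ρ W) (All.lookup ρ S) (All.lookup ρ a) (All.lookup ρ x)
    to any with (y , z) , yz∈ , refl , y∉S , x∈ ← ListMem.find any = clash yz∈ y∉S x∈
    from : Conflict (All.lookup ρ W) (All.lookup ρ S) (All.lookup ρ a) (All.lookup ρ x) → Any Shared (All.lookup ρ W)
    from (clash a∈ y∉S x∈) = ListMem.lose a∈ (refl , y∉S , x∈)
    test : (yz : ℕ × ℕ) (b : Bool) → Reflects (Shared yz) _
    test (y , z) b =
      let ρ′ : Env (nat ∷ nat ⊗ nat ∷ bool ∷ _)
          ρ′ = y ∷ (y , z) ∷ b ∷ ρ
      in and-reflects (=-reflects z (All.lookup ρ a))
           (and-reflects (not-reflects (member-reflects ρ′ x₀ (↑3 S))) (related-reflects ρ′ x₀ (↑3 x) (↑3 W)))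

-- Paths

module RealProperties (ℝ : Reals) where
  open Reals ℝ renaming (_+_ to _+ʳ_; _≤_ to _≤ʳ_; _<_ to _<ʳ_)
  open CommutativeRing commutativeRing public
    using (+-comm; +-identityʳ; +-identityˡ; +-assoc; -‿inverseʳ; +-congˡ; +-congʳ)
  open IsDecTotalOrder isDecTotalOrder public
    using () renaming (trans to ≤-trans; reflexive to ≤-reflexive; antisym to ≤-antisym;
                       total to ≤-total; refl to ≤-refl; module Eq to ≈)

  poset : Poset 0ℓ 0ℓ 0ℓ
  poset = record { isPartialOrder = IsDecTotalOrder.isPartialOrder isDecTotalOrder }

  +-mono₂ : ∀ {w x y z} → w ≤ʳ x → y ≤ʳ z → w +ʳ y ≤ʳ x +ʳ z
  +-mono₂ {w} {x} {y} {z} w≤x y≤z = ≤-trans (+-mono w y≤z)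
    (≤-trans (≤-reflexive (+-comm w z)) (≤-trans (+-mono z w≤x) (≤-reflexive (+-comm z x))))

  x≤y+x : ∀ {x y} → 0# ≤ʳ y → x ≤ʳ y +ʳ x
  x≤y+x 0≤y = ≤-trans (≤-reflexive (≈.sym (+-identityˡ _))) (+-mono₂ 0≤y ≤-refl)

  x≤x+y : ∀ {x y} → 0# ≤ʳ y → x ≤ʳ x +ʳ y
  x≤x+y 0≤y = ≤-trans (≤-reflexive (≈.sym (+-identityʳ _))) (+-mono _ 0≤y)

  -- This is why `r + r` can stand for +∞: it never passes the test against `r`.
  r+r≰r : ∀ {r} → 0# <ʳ r → ¬ (r +ʳ r ≤ʳ r)
  r+r≰r {r} (0≤r , 0≉r) r+r≤r = 0≉r (≤-antisym 0≤r (begin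
    r                ≈⟨ +-identityʳ r ⟨
    r +ʳ 0#          ≈⟨ +-congˡ (-‿inverseʳ r) ⟨
    r +ʳ (r +ʳ - r)  ≈⟨ +-assoc r r (- r) ⟨
    r +ʳ r +ʳ - r    ≤⟨ +-mono₂ r+r≤r ≤-refl ⟩
    r +ʳ - r         ≈⟨ -‿inverseʳ r ⟩
    0#               ∎))
    where open import Relation.Binary.Reasoning.PartialOrder poset

  ≰⇒> : ∀ {x y} → ¬ (x ≤ʳ y) → y <ʳ x
  ≰⇒> {x} {y} x≰y with ≤-total x y
  ... | inj₁ x≤y = contradiction x≤y x≰y
  ... | inj₂ y≤x = y≤x , λ y≈x → x≰y (≤-reflexive (≈.sym y≈x))

module PathProperties (ℝ : Reals) {n : ℕ} (G : Graphs.WeightedGraph ℝ n) where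
  open Reals ℝ renaming (_+_ to _+ʳ_; _≤_ to _≤ʳ_; _<_ to _<ʳ_)
  open RealProperties ℝ
  open Graphs ℝ renaming (length to pathLength)
  open WeightedGraph G

  private variable
    U V : Subset n
    u v w : Fin n
    d e : Carrier

  length-nonNegative : (p : Path G U u v) → 0# ≤ʳ pathLength G p
  length-nonNegative [ _ ]          = ≤-refl
  length-nonNegative (_ ∷⟨ e ⟩ p) = ≤-trans (length-nonNegative p) (x≤y+x (nonNegative e))

  infix 4 _⊢_⇝_[_]

  -- An upper bound instead of the exact length: paths do not repeat vertices, so joining two of
  -- them may require cutting out a detour, which can shorten the path.
  record _⊢_⇝_[_] (U : Subset n) (u v : Fin n) (d : Carrier) : Set where
    constructor _,_
    field
      path  : Path G U u v
      short : pathLength G path ≤ʳ d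

  head∈ : Path G U u v → u ∈ U
  head∈ [ u∈ ]          = u∈
  head∈ (u∈ ∷⟨ _ ⟩ _) = u∈

  -⊆ : U - v ⊆ U
  -⊆ {U} {v} = p─q⊆p U _

  -- Deleting `u` a second time changes nothing, whereas deleting a member would lower the
  -- cardinality.
  x∉p-x : (U : Subset n) → u ∉ U - u
  x∉p-x {u} U u∈ = ℕ.<-irrefl (cong ∣_∣ (p─q─q≡p─q U ⁅ u ⁆)) (x∈p⇒∣p-x∣<∣p∣ u∈)

  -mono : U ⊆ V → U - u ⊆ V - u
  -mono {U = U} {V = V} {u = u} U⊆V {x} x∈ with x ≟ u
  ... | yes refl = contradiction x∈ (x∉p-x U)
  ... | no x≢u   = x∈p∧x≢y⇒x∈p-y (U⊆V (-⊆ x∈)) x≢u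

  ⇝-weaken : U ⊆ V → d ≤ʳ e → U ⊢ u ⇝ v [ d ] → V ⊢ u ⇝ v [ e ]
  ⇝-weaken U⊆V d≤e (p , p≤d) =
    let q , q≡ = widen U⊆V p
    in q , ≤-trans (≤-reflexive (≈.reflexive q≡)) (≤-trans p≤d d≤e)
    where
    widen : ∀ {U V u v} → U ⊆ V → (p : Path G U u v) → ∃ λ (q : Path G V u v) → pathLength G q ≡ pathLength G p
    widen U⊆V [ u∈ ]          = [ U⊆V u∈ ] , refl
    widen U⊆V (u∈ ∷⟨ e ⟩ p) = let q , q≡ = widen (-mono U⊆V) p in U⊆V u∈ ∷⟨ e ⟩ q , cong (_ +ʳ_) q≡

  ⇝-refl : u ∈ U → U ⊢ u ⇝ u [ 0# ]
  ⇝-refl u∈ = [ u∈ ] , ≤-refl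

  -- If u lies on p, the path from u is a suffix of p.
  shortcut : (p : Path G U v w) → ∀ u → u ∈ U →
             U ⊢ u ⇝ w [ pathLength G p ] ⊎ (U - u) ⊢ v ⇝ w [ pathLength G p ]
  shortcut {v = v} [ v∈ ] u u∈ with u ≟ v
  ... | yes refl = inj₁ ([ v∈ ] , ≤-refl)
  ... | no u≢v   = inj₂ ([ x∈p∧x≢y⇒x∈p-y v∈ (u≢v ∘ sym) ] , ≤-refl)
  shortcut {U = U} {v = v} (v∈ ∷⟨ e ⟩ p) u u∈ with u ≟ v
  ... | yes refl = inj₁ (v∈ ∷⟨ e ⟩ p , ≤-refl)
  ... | no u≢v with shortcut p u (x∈p∧x≢y⇒x∈p-y u∈ u≢v)
  ...   | inj₁ q = inj₁ (⇝-weaken -⊆ (x≤y+x (nonNegative e)) q)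
  ...   | inj₂ q with q , q≤ ← ⇝-weaken (λ {x} → subst (x ∈_) (p─x─y≡p─y─x U v u)) ≤-refl q =
    inj₂ (x∈p∧x≢y⇒x∈p-y v∈ (u≢v ∘ sym) ∷⟨ e ⟩ q , +-mono _ q≤)

  -- If the path already visits `u`, the new edge is dropped and the part of the path from `u` on is
  -- taken.
  ⇝-cons : u ∈ U → Adj u v → U ⊢ v ⇝ w [ d ] → U ⊢ u ⇝ w [ weight u v +ʳ d ]
  ⇝-cons {u = u} u∈ e (p , p≤) with shortcut p u u∈
  ... | inj₁ q        = ⇝-weaken id (≤-trans p≤ (x≤y+x (nonNegative e))) q
  ... | inj₂ (q , q≤) = u∈ ∷⟨ e ⟩ q , +-mono _ (≤-trans q≤ p≤)

  ⇝-trans : U ⊢ u ⇝ v [ d ] → U ⊢ v ⇝ w [ e ] → U ⊢ u ⇝ w [ d +ʳ e ]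
  ⇝-trans {U} {e = e} (p , p≤d) q = ⇝-weaken id (+-mono₂ p≤d ≤-refl) (go id p q)
    where
    -- The first path lives in ever smaller subgraphs while the second stays in `U`, hence the
    -- auxiliary `U′`.
    go : ∀ {U′ u v w} → U′ ⊆ U → (p : Path G U′ u v) → U ⊢ v ⇝ w [ e ] → U ⊢ u ⇝ w [ pathLength G p +ʳ e ]
    go _     [ _ ]           q = ⇝-weaken id (≤-reflexive (≈.sym (+-identityˡ e))) q
    go U′⊆U (u∈ ∷⟨ a ⟩ p) q =
      ⇝-weaken id (≤-reflexive (≈.sym (+-assoc _ _ e))) (⇝-cons (U′⊆U u∈) a (go (U′⊆U ∘ -⊆) p q))

  ⇝-sym : U ⊢ u ⇝ v [ d ] → U ⊢ v ⇝ u [ d ]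
  ⇝-sym {U} (p , p≤d) = ⇝-weaken id p≤d (go id p)
    where
    go : ∀ {U′ u v} → U′ ⊆ U → (p : Path G U′ u v) → U ⊢ v ⇝ u [ pathLength G p ]
    go U′⊆U [ u∈ ]                  = ⇝-refl (U′⊆U u∈)
    go U′⊆U (_∷⟨_⟩_ {u} {v} u∈ a p) = ⇝-weaken id
      (≤-reflexive (≈.trans (+-comm _ _) (+-congʳ (≈.trans (+-identityʳ _) (weight-sym (adj-sym a))))))
      (⇝-trans (go (U′⊆U ∘ -⊆) p) (⇝-cons (U′⊆U (-⊆ (head∈ p))) (adj-sym a) (⇝-refl (U′⊆U u∈))))

  module _ {k : ℕ} (𝒫 : Partition n k) {_⪯_ : Rel (Fin k) 0ℓ} (⪯-ord : IsDecTotalOrder _≡_ _⪯_) where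
    open Partition 𝒫
    open IsDecTotalOrder ⪯-ord using () renaming (_≤?_ to _⪯?_; total to ⪯-total; trans to ⪯-trans; refl to ⪯-refl)

    upward : Fin k → Subset n
    upward Y = ⋃ (comprehension (Y ⪯?_))

    ∈-upward⁺ : ∀ {Y v} → Y ⪯ part v → v ∈ upward Y
    ∈-upward⁺ Y⪯ = ∈-comprehension⁺ (λ v → part v ∈? _) (∈-comprehension⁺ (_ ⪯?_) Y⪯)

    ∈-upward⁻ : ∀ {Y v} → v ∈ upward Y → Y ⪯ part v
    ∈-upward⁻ v∈ = ∈-comprehension⁻ (_ ⪯?_) (∈-comprehension⁻ (λ v → part v ∈? _) v∈)

    -- `bottom∈` is recorded because, for `U` the complement of a union of parts, it shows that the
    -- bottom's part is none of these.
    record Bottleneck (U : Subset n) (u v : Fin n) (ℓ : Carrier) : Set where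
      field
        {bottom}      : Fin n
        {left right}  : Carrier
        bottom∈       : bottom ∈ U
        leftPath      : upward (part bottom) ⊢ u ⇝ bottom [ left ]
        rightPath     : upward (part bottom) ⊢ bottom ⇝ v [ right ]
        total≤        : left +ʳ right ≤ʳ ℓ

    -- The bottom is a vertex of the ⪯-least part that the path meets.
    bottleneck : (p : Path G U u v) → Bottleneck U u v (pathLength G p)
    bottleneck [ v∈ ] = record
      { bottom∈ = v∈ ; leftPath = ⇝-refl (∈-upward⁺ ⪯-refl) ; rightPath = ⇝-refl (∈-upward⁺ ⪯-refl)
      ; total≤ = ≤-reflexive (+-identityʳ _) }
    bottleneck (_∷⟨_⟩_ {u} u∈ a p) with bottleneck p
    ... | record { bottom = y ; bottom∈ = y∈ ; leftPath = l ; rightPath = r ; total≤ = l+r≤ }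
      with ⪯-total (part y) (part u)
    ... | inj₁ y⪯u = record
      { bottom∈ = -⊆ y∈ ; leftPath = ⇝-cons (∈-upward⁺ y⪯u) a l ; rightPath = r
      ; total≤ = ≤-trans (≤-reflexive (+-assoc _ _ _)) (+-mono _ l+r≤) }
    -- Now `u` is the new bottom: the left half is trivial, and the two old halves are joined inside
    -- the larger subgraph above the part of `u`.
    ... | inj₂ u⪯y = record
      { bottom∈ = u∈ ; leftPath = ⇝-refl (∈-upward⁺ ⪯-refl)
      ; rightPath = ⇝-cons (∈-upward⁺ ⪯-refl) a (⇝-trans (raise l) (raise r))
      ; total≤ = ≤-trans (≤-reflexive (+-identityˡ _)) (+-mono _ l+r≤) }
      where
      raise : ∀ {x z d} → upward (part y) ⊢ x ⇝ z [ d ] → upward (part u) ⊢ x ⇝ z [ d ]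
      raise = ⇝-weaken (λ x∈ → ∈-upward⁺ (⪯-trans u⪯y (∈-upward⁻ x∈))) ≤-refl

    ⇝⇒weaklyReachable : ∀ {r Y x y} → part y ≡ Y → upward Y ⊢ x ⇝ y [ r ] →
                        WeaklyReachable G 𝒫 ⪯-ord r (part x) Y
    ⇝⇒weaklyReachable y∈Y (p , p≤r) =
      _ , _ , ∈-comprehension⁺ (λ v → part v ≟ _) refl , ∈-comprehension⁺ (λ v → part v ≟ _) y∈Y , p , p≤r

    weaklyReachable⇒⇝ : ∀ {r X Y} → WeaklyReachable G 𝒫 ⪯-ord r X Y →
                         ∃₂ λ x y → part x ≡ X × part y ≡ Y × upward Y ⊢ x ⇝ y [ r ]
    weaklyReachable⇒⇝ (x , y , x∈X , y∈Y , p , p≤r) =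
      x , y , ∈-comprehension⁻ (λ v → part v ≟ _) x∈X , ∈-comprehension⁻ (λ v → part v ≟ _) y∈Y , (p , p≤r)

    weaklyReachable⇒⪯ : ∀ {r X Y} → WeaklyReachable G 𝒫 ⪯-ord r X Y → Y ⪯ X
    weaklyReachable⇒⪯ w with x , y , refl , _ , (p , _) ← weaklyReachable⇒⇝ w = ∈-upward⁻ (head∈ p)

    weaklyReachable-refl : ∀ {r} → 0# ≤ʳ r → ∀ X → WeaklyReachable G 𝒫 ⪯-ord r X X
    weaklyReachable-refl 0≤r X with x , refl ← surjective X =
      ⇝⇒weaklyReachable refl (⇝-weaken id 0≤r (⇝-refl (∈-upward⁺ ⪯-refl)))

    -- Neither half of the path has negative length, so both are at most `r`. The right half is
    -- reversed, since it has to lead from `x₂` to the bottom.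
    meeting-part : ∀ {S r x₁ x₂} (p : Path G (∁ (⋃ S)) x₁ x₂) → pathLength G p ≤ʳ r →
      ∃ λ Y → Y ∉ S × WeaklyReachable G 𝒫 ⪯-ord r (part x₁) Y × WeaklyReachable G 𝒫 ⪯-ord r (part x₂) Y
    meeting-part {S} p p≤r with bottleneck p
    ... | record { bottom = y ; bottom∈ = y∈ ; leftPath = l , l≤ ; rightPath = q , q≤ ; total≤ = l+q≤ } =
      part y , (λ Y∈S → x∈∁p⇒x∉p y∈ (∈-comprehension⁺ (λ v → part v ∈? S) Y∈S))
      , ⇝⇒weaklyReachable refl (⇝-weaken id (≤-trans (x≤x+y (≤-trans (length-nonNegative q) q≤)) l+q≤r) (l , l≤))
      , ⇝⇒weaklyReachable refl (⇝-weaken id (≤-trans (x≤y+x (≤-trans (length-nonNegative l) l≤)) l+q≤r) (⇝-sym (q , q≤)))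
      where l+q≤r = ≤-trans l+q≤ p≤r

-- Shortest paths

module BellmanFord (ℝ : Reals) where
  open Reals ℝ renaming (_+_ to _+ʳ_; _≤_ to _≤ʳ_; _<_ to _<ʳ_)
  open RealProperties ℝ
  open Semantics ℝ
  open Graphs ℝ renaming (length to pathLength)

  min : Carrier → Carrier → Carrier
  min x y = if does (x ≤? y) then x else y

  min≤ˡ : ∀ x y → min x y ≤ʳ x
  min≤ˡ x y with x ≤? y
  ... | yes _ = ≤-refl
  ... | no x≰y = proj₁ (≰⇒> x≰y)

  min≤ʳ : ∀ x y → min x y ≤ʳ y
  min≤ʳ x y with x ≤? y
  ... | yes x≤y = x≤y
  ... | no _    = ≤-refl

  min-preserves : ∀ (Q : Carrier → Set) {x y} → Q x → Q y → Q (min x y)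
  min-preserves Q {x} {y} Qx Qy with does (x ≤? y)
  ... | true  = Qx
  ... | false = Qy

  Table : Set
  Table = List (ℕ × Carrier)

  -- `scan` and `lowered` are the two nested folds in the body of `relax`.
  scan : Table → ℕ → Carrier → Carrier → Carrier
  scan D b w d = foldr (λ (u , e) d → if u ≡ᵇ b then min (w +ʳ e) d else d) d D

  scan-step-≤ : ∀ c x d → (if c then min x d else d) ≤ʳ d
  scan-step-≤ true  x d = min≤ʳ x d
  scan-step-≤ false x d = ≤-refl

  scan-≤ : ∀ D b w d → scan D b w d ≤ʳ d
  scan-≤ D b w d = foldr-preserves (_≤ʳ d) D ≤-refl
    λ { {u , e} {y} _ y≤ → ≤-trans (scan-step-≤ (u ≡ᵇ b) (w +ʳ e) y) y≤ }

  scan-attains : ∀ {D b e} w d → (b , e) ListMem.∈ D → scan D b w d ≤ʳ w +ʳ e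
  scan-attains {D} {b} {e} w d e∈ = foldr-attains (_≤ʳ w +ʳ e) e∈ attain
    (λ { {u , e′} {y} y≤ → ≤-trans (scan-step-≤ (u ≡ᵇ b) (w +ʳ e′) y) y≤ })
    where
    attain : ∀ {y} → (if b ≡ᵇ b then min (w +ʳ e) y else y) ≤ʳ w +ʳ e
    attain {y} with b ≡ᵇ b | =-reflects b b
    ... | _ | ofʸ _  = min≤ˡ (w +ʳ e) y
    ... | _ | ofⁿ b≢ = contradiction refl b≢

  scan-preserves : ∀ (Q : Carrier → Set) D b w {d} → Q d →
    (∀ {e} → (b , e) ListMem.∈ D → Q (w +ʳ e)) → Q (scan D b w d)
  scan-preserves Q D b w Qd step = foldr-preserves Q D Qd go
    where
    go : ∀ {ue y} → ue ListMem.∈ D → Q y → Q (if proj₁ ue ≡ᵇ b then min (w +ʳ proj₂ ue) y else y)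
    go {u , e} ue∈ Qy with u ≡ᵇ b | =-reflects u b
    ... | _ | ofʸ refl = min-preserves Q (step ue∈) Qy
    ... | _ | ofⁿ _    = Qy

  Edges : Set
  Edges = List (ℕ × ℕ × Carrier)

  lowered : Edges → Table → ℕ → Carrier → Carrier
  lowered E D a d = foldr (λ (v , u , w) d → if v ≡ᵇ a then scan D u w d else d) d E

  lowered-step-≤ : ∀ c D u w d → (if c then scan D u w d else d) ≤ʳ d
  lowered-step-≤ true  D u w d = scan-≤ D u w d
  lowered-step-≤ false D u w d = ≤-refl

  lowered-≤ : ∀ E D a d → lowered E D a d ≤ʳ d
  lowered-≤ E D a d = foldr-preserves (_≤ʳ d) E ≤-refl
    λ { {v , u , w} {y} _ y≤ → ≤-trans (lowered-step-≤ (v ≡ᵇ a) D u w y) y≤ }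

  lowered-attains : ∀ {E D a b w e} d → (a , b , w) ListMem.∈ E → (b , e) ListMem.∈ D →
                      lowered E D a d ≤ʳ w +ʳ e
  lowered-attains {E} {D} {a} {b} {w} {e} d w∈ e∈ = foldr-attains (_≤ʳ w +ʳ e) w∈ attain
    (λ { {v , u , w} {y} y≤ → ≤-trans (lowered-step-≤ (v ≡ᵇ a) D u w y) y≤ })
    where
    attain : ∀ {y} → (if a ≡ᵇ a then scan D b w y else y) ≤ʳ w +ʳ e
    attain {y} with a ≡ᵇ a | =-reflects a a
    ... | _ | ofʸ _  = scan-attains w y e∈
    ... | _ | ofⁿ a≢ = contradiction refl a≢

  -- A minimum is one of its arguments, so what holds of the old entry and of every candidate holds
  -- of the new entry. This gives the soundness of a round; `lowered-attains` gives its
  -- completeness.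
  lowered-preserves : ∀ (Q : Carrier → Set) E D a {d} → Q d →
    (∀ {b w e} → (a , b , w) ListMem.∈ E → (b , e) ListMem.∈ D → Q (w +ʳ e)) → Q (lowered E D a d)
  lowered-preserves Q E D a Qd step = foldr-preserves Q E Qd go
    where
    go : ∀ {vuw y} → vuw ListMem.∈ E → Q y →
         Q (if proj₁ vuw ≡ᵇ a then scan D (proj₁ (proj₂ vuw)) (proj₂ (proj₂ vuw)) y else y)
    go {v , u , w} w∈ Qy with v ≡ᵇ a | =-reflects v a
    ... | _ | ofʸ refl = scan-preserves Q D u w Qy (step w∈)
    ... | _ | ofⁿ _    = Qy

  relaxed : Edges → Table → Table
  relaxed E D = value (relax x₀ x₁) (E ∷ D ∷ [])

  start : ℕ → Carrier → (P L : List (ℕ × ℕ)) → Table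
  start y r P L = value (initial x₀ x₁ x₂ x₃) (y ∷ r ∷ P ∷ L ∷ [])

  table : ℕ → Edges → Carrier → (P L : List (ℕ × ℕ)) → Table
  table y E r P L = value (distances x₀ x₁ x₂ x₃ (↑2 x₂)) (y ∷ E ∷ r ∷ P ∷ L ∷ [])

  true-reflects : Reflects ⊤ true
  true-reflects = ofʸ _

  ∈-relaxed⁻ : ∀ {E D a d} → (a , d) ListMem.∈ relaxed E D →
                 ∃ λ d′ → (a , d′) ListMem.∈ D × d ≡ lowered E D a d′
  ∈-relaxed⁻ {E} {D} d∈
    with (_ , d′) , _ , d′∈ , _ , refl ← ∈-collecting⁻ (λ _ _ → true-reflects) D d∈ =
    d′ , d′∈ , refl

  ∈-relaxed⁺ : ∀ {E D a d} → (a , d) ListMem.∈ D → (a , lowered E D a d) ListMem.∈ relaxed E D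
  ∈-relaxed⁺ {E} d∈ = proj₂ (∈-collecting⁺ (λ _ _ → true-reflects) d∈ _)

  ∈-start⁻ : ∀ {y r P L a d} → (a , d) ListMem.∈ start y r P L →
             ∃ λ z → (a , z) ListMem.∈ P × (y , z) ListMem.∈ L × d ≡ (if z ≡ᵇ y then 0# else r +ʳ r)
  ∈-start⁻ {y} {r} {P} {L} d∈
    with (_ , z) , _ , z∈ , z∈L , refl ← ∈-collecting⁻ {P = λ (_ , z) → (y , z) ListMem.∈ L}
           (λ (_ , z) _ → Spec.related-reflects ℝ (y ∷ z ∷ L ∷ []) x₀ x₁ x₂) P d∈ = z , z∈ , z∈L , refl

  ∈-start⁺ : ∀ {y r P L a z} → (a , z) ListMem.∈ P → (y , z) ListMem.∈ L →
             (a , (if z ≡ᵇ y then 0# else r +ʳ r)) ListMem.∈ start y r P L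
  ∈-start⁺ {y} {L = L} z∈ z∈L = proj₂ (∈-collecting⁺ {P = λ (_ , z) → (y , z) ListMem.∈ L}
    (λ (_ , z) _ → Spec.related-reflects ℝ (y ∷ z ∷ L ∷ []) x₀ x₁ x₂) z∈ z∈L)

  module _ {m n : ℕ} {R : Fin m → Fin n → Set} (R? : ∀ i j → Dec (R i j)) where

    ∈-encodeRel⁺ : ∀ {i j} → R i j → (toℕ i , toℕ j) ListMem.∈ encodeRel R?
    ∈-encodeRel⁺ {i} {j} Rij = ∈-map⁺ _
      (∈-filter⁺ (λ (i , j) → R? i j) (∈-cartesianProduct⁺ (∈-allFin i) (∈-allFin j)) Rij)

    ∈-encodeRel⁻ : ∀ {a b} → (a , b) ListMem.∈ encodeRel R? → ∃₂ λ i j → a ≡ toℕ i × b ≡ toℕ j × R i j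
    ∈-encodeRel⁻ ab∈ with (i , j) , ij∈ , refl ← ∈-map⁻ _ ab∈ =
      i , j , refl , refl ,
        proj₂ (∈-filter⁻ (λ (i , j) → R? i j) {xs = cartesianProduct (allFin m) (allFin n)} ij∈)

  module _ {n : ℕ} (G : WeightedGraph n) where
    open WeightedGraph G

    ∈-encodeEdges⁺ : ∀ {u v} → Adj u v → (toℕ u , toℕ v , weight u v) ListMem.∈ encodeEdges G
    ∈-encodeEdges⁺ {u} {v} a = ∈-map⁺ _
      (∈-filter⁺ (λ (u , v) → adj? u v) (∈-cartesianProduct⁺ (∈-allFin u) (∈-allFin v)) a)

    ∈-encodeEdges⁻ : ∀ {a b w} → (a , b , w) ListMem.∈ encodeEdges G →
                     ∃₂ λ u v → a ≡ toℕ u × b ≡ toℕ v × w ≡ weight u v × Adj u v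
    ∈-encodeEdges⁻ ab∈ with (u , v) , uv∈ , refl ← ∈-map⁻ _ ab∈ =
      u , v , refl , refl , refl ,
        proj₂ (∈-filter⁻ (λ (u , v) → adj? u v) {xs = cartesianProduct (allFin n) (allFin n)} uv∈)

  module _ {n k : ℕ} (G : WeightedGraph n) (𝒫 : Partition n k)
           {_⪯_ : Rel (Fin k) 0ℓ} (⪯-ord : IsDecTotalOrder _≡_ _⪯_) (r : Carrier) (0<r : 0# <ʳ r) where
    open WeightedGraph G
    open Partition 𝒫
    open IsDecTotalOrder ⪯-ord using () renaming (_≤?_ to _⪯?_; refl to ⪯-refl)
    open PathProperties ℝ G

    private
      E = encodeEdges G
      P = encodeRel (λ v X → part v ≟ X)
      L = encodeRel _⪯?_
      _↗ : Fin k → Subset n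
      Y ↗ = upward 𝒫 ⪯-ord Y

    module _ (Y : Fin k) where

      -- Entries above `r` may stem from the `r + r` in place of +∞, so nothing is claimed about
      -- paths of such a length.
      record Sound (a : ℕ) (d : Carrier) : Set where
        constructor sound
        field
          {v}     : Fin n
          a≡v     : a ≡ toℕ v
          v∈      : v ∈ Y ↗
          reached : d ≤ʳ r → ∃ λ y → part y ≡ Y × Y ↗ ⊢ v ⇝ y [ d ]

      SoundTable : Table → Set
      SoundTable D = ∀ {a d} → (a , d) ListMem.∈ D → Sound a d

      start-sound : SoundTable (start (toℕ Y) r P L)
      start-sound d∈
        with z , z∈P , z∈L , refl ← ∈-start⁻ {toℕ Y} {r} {P} {L} d∈
        with v , _ , refl , refl , refl ← ∈-encodeRel⁻ (λ v X → part v ≟ X) z∈P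
        with Y′ , Z , Y≡ , Z≡ , Y⪯Z ← ∈-encodeRel⁻ _⪯?_ z∈L
        with refl ← toℕ-injective Y≡ | refl ← toℕ-injective Z≡ =
        sound refl (∈-upward⁺ 𝒫 ⪯-ord Y⪯Z) reached
        where
        reached : (if toℕ (part v) ≡ᵇ toℕ Y then 0# else r +ʳ r) ≤ʳ r →
                  ∃ λ y → part y ≡ Y × Y ↗ ⊢ v ⇝ y [ if toℕ (part v) ≡ᵇ toℕ Y then 0# else r +ʳ r ]
        reached d≤r with toℕ (part v) ≡ᵇ toℕ Y | =-reflects (toℕ (part v)) (toℕ Y)
        ... | _ | ofʸ v∈Y = v , toℕ-injective v∈Y , ⇝-refl (∈-upward⁺ 𝒫 ⪯-ord Y⪯Z)
        ... | _ | ofⁿ _   = contradiction d≤r (r+r≰r 0<r)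

      relaxed-sound : ∀ {D} → SoundTable D → SoundTable (relaxed E D)
      relaxed-sound {D} s {a} d∈ with d , d∈D , refl ← ∈-relaxed⁻ {E} {D} d∈ =
        lowered-preserves (Sound a) E D a (s d∈D) step
        where
        step : ∀ {b w e} → (a , b , w) ListMem.∈ E → (b , e) ListMem.∈ D → Sound a (w +ʳ e)
        step w∈ e∈ with u , u′ , refl , refl , refl , adj ← ∈-encodeEdges⁻ G w∈ with s d∈D | s e∈
        ... | sound u≡ u∈ _ | sound u′≡ u′∈ reached with refl ← toℕ-injective u≡ | refl ← toℕ-injective u′≡ =
          -- The weight is nonnegative, so `e` is at most `r` as well and stands for an actual path.
          sound refl u∈ λ w+e≤r →
            let y , y∈Y , p = reached (≤-trans (x≤y+x (nonNegative adj)) w+e≤r)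
            in y , y∈Y , ⇝-cons u∈ adj p

      -- The induction is on the number of available vertices, which drops at each edge of a path.
      -- `source` settles the paths of one vertex, and `total` provides the entry that a round can
      -- lower.
      record Covers (i : ℕ) (D : Table) : Set where
        field
          total  : ∀ {v} → v ∈ Y ↗ → ∃ λ d → (toℕ v , d) ListMem.∈ D
          source : ∀ {y} → part y ≡ Y → ∃ λ d → (toℕ y , d) ListMem.∈ D × d ≤ʳ 0#
          short  : ∀ {U v y} → U ⊆ Y ↗ → ∣ U ∣ ℕ.≤ i → part y ≡ Y → (p : Path G U v y) →
                   ∃ λ d → (toℕ v , d) ListMem.∈ D × d ≤ʳ pathLength G p
      open Covers

      start-covers : Covers 0 (start (toℕ Y) r P L)
      start-covers .total {v} v∈ = _ , ∈-start⁺ {toℕ Y} {r} {P} {L} (∈-encodeRel⁺ (λ v X → part v ≟ X) refl)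
        (∈-encodeRel⁺ _⪯?_ (∈-upward⁻ 𝒫 ⪯-ord v∈))
      start-covers .source {y} refl = _ ,
        ∈-start⁺ {toℕ Y} {r} {P} {L} (∈-encodeRel⁺ (λ v X → part v ≟ X) refl)
        (∈-encodeRel⁺ _⪯?_ ⪯-refl) , zero≤
        where
        zero≤ : (if toℕ (part y) ≡ᵇ toℕ (part y) then 0# else r +ʳ r) ≤ʳ 0#
        zero≤ with toℕ (part y) ≡ᵇ toℕ (part y) | =-reflects (toℕ (part y)) (toℕ (part y))
        ... | _ | ofʸ _ = ≤-refl
        ... | _ | ofⁿ y≢y = contradiction refl y≢y
      -- A path has at least one vertex, so nothing is claimed before the first round.
      start-covers .short _ ∣U∣≤0 _ p = contradiction (ℕ.<-≤-trans (x∈p⇒∣p-x∣<∣p∣ (head∈ p)) ∣U∣≤0) λ ()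

      relaxed-covers : ∀ {i D} → Covers i D → Covers (suc i) (relaxed E D)
      relaxed-covers c .total v∈ = let _ , d∈ = c .total v∈ in _ , ∈-relaxed⁺ {E} d∈
      relaxed-covers {D = D} c .source y∈Y = let _ , d∈ , d≤ = c .source y∈Y in
        _ , ∈-relaxed⁺ {E} d∈ , ≤-trans (lowered-≤ E D _ _) d≤
      relaxed-covers c .short _ _ y∈Y [ _ ] = relaxed-covers c .source y∈Y
      relaxed-covers {D = D} c .short U⊆ ∣U∣≤ y∈Y (u∈ ∷⟨ a ⟩ p) =
        let _ , d∈ = c .total (U⊆ u∈)
            _ , e∈ , e≤ = c .short (U⊆ ∘ -⊆) (ℕ.s≤s⁻¹ (ℕ.<-≤-trans (x∈p⇒∣p-x∣<∣p∣ u∈) ∣U∣≤)) y∈Y p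
        in _ , ∈-relaxed⁺ {E} d∈ , ≤-trans (lowered-attains {E} {D} _ (∈-encodeEdges⁺ G a) e∈) (+-mono _ e≤)

      length-P : n ℕ.≤ List.length P
      length-P = subst₂ ℕ._≤_ (trans (length-map toℕ (allFin n)) (length-tabulate id)) (length-map proj₁ P)
        (unique-⊆⇒length≤ (unique-map⁺ toℕ-injective (allFin⁺ n)) vertices⊆)
        where
        vertices⊆ : ∀ {a} → a ListMem.∈ map toℕ (allFin n) → a ListMem.∈ map proj₁ P
        vertices⊆ a∈ with v , _ , refl ← ∈-map⁻ toℕ a∈ = ∈-map⁺ proj₁ (∈-encodeRel⁺ (λ v X → part v ≟ X) refl)

      table-covers : Covers (List.length P) (table (toℕ Y) E r P L)
      table-covers = foldr-counts Covers P start-covers relaxed-covers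

      table-sound : SoundTable (table (toℕ Y) E r P L)
      table-sound = foldr-counts (λ _ → SoundTable) P start-sound relaxed-sound

    Reached : (x y : ℕ) → Set
    Reached x y = Any (λ (v , z) → z ≡ x × Any (λ (u , d) → u ≡ v × d ≤ʳ r) (table y E r P L)) P

    reaches-reflects : ∀ {Γ} (ρ : Env Γ) x y → Reflects (Reached x y)
      (value (reaches x₀ x₁ x₂ x₃ (↑2 x₂) (↑2 x₃)) (y ∷ E ∷ r ∷ P ∷ L ∷ x ∷ ρ))
    reaches-reflects ρ x y = some-reflects (λ (v , z) _ → and-reflects (=-reflects z x)
      (some-reflects (λ (u , d) _ → and-reflects (=-reflects u v) (proof (d ≤? r))) (table y E r P L))) P

    reached⁻ : ∀ {X Y} → Reached (toℕ X) (toℕ Y) → WeaklyReachable G 𝒫 ⪯-ord r X Y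
    reached⁻ {X} {Y} any
      with (_ , _) , z∈ , z≡X , any′ ← ListMem.find any
      with (_ , d) , d∈ , refl , d≤r ← ListMem.find any′
      with v , _ , refl , refl , refl ← ∈-encodeRel⁻ (λ v X → part v ≟ X) z∈
      with refl ← toℕ-injective z≡X
      with table-sound Y d∈
    ... | sound v≡ _ reached with refl ← toℕ-injective v≡ with y , y∈Y , p ← reached d≤r =
      ⇝⇒weaklyReachable 𝒫 ⪯-ord y∈Y (⇝-weaken id d≤r p)

    reached⁺ : ∀ {X Y} → WeaklyReachable G 𝒫 ⪯-ord r X Y → Reached (toℕ X) (toℕ Y)
    reached⁺ {X} {Y} w
      with x , y , refl , y∈Y , (p , p≤r) ← weaklyReachable⇒⇝ 𝒫 ⪯-ord w
      with d , d∈ , d≤ ← table-covers Y .Covers.short id (ℕ.≤-trans (∣p∣≤n (Y ↗)) (length-P Y)) y∈Y p =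
      ListMem.lose (∈-encodeRel⁺ (λ v X → part v ≟ X) refl) (refl , ListMem.lose d∈ (refl , ≤-trans d≤ p≤r))

    pairs : List (ℕ × ℕ)
    pairs = value (reachability x₀ x₁ x₂ x₃) (E ∷ r ∷ P ∷ L ∷ [])

    ∈-pairs⁺ : ∀ {X Y} → WeaklyReachable G 𝒫 ⪯-ord r X Y → (toℕ Y , toℕ X) ListMem.∈ pairs
    ∈-pairs⁺ w = proj₂ (∈-collecting⁺ {P = λ (y , x) → Reached x y} (λ (y , x) _ → reaches-reflects [] x y)
      (∈-encodeRel⁺ _⪯?_ (weaklyReachable⇒⪯ 𝒫 ⪯-ord w)) (reached⁺ w))

    ∈-pairs⁻ : ∀ {y x} → (y , x) ListMem.∈ pairs →
               ∃₂ λ Y X → y ≡ toℕ Y × x ≡ toℕ X × WeaklyReachable G 𝒫 ⪯-ord r X Y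
    ∈-pairs⁻ yx∈
      with _ , _ , ∈L , reached , refl ← ∈-collecting⁻ {P = λ (y , x) → Reached x y}
           (λ (y , x) _ → reaches-reflects [] x y) L yx∈
      with Y , X , refl , refl , _ ← ∈-encodeRel⁻ _⪯?_ ∈L = Y , X , refl , refl , reached⁻ reached

-- The search

length-concatMap : {A B : Set} (f : A → List B) {ℓ : ℕ} (xs : List A) →
  (∀ {x} → x ListMem.∈ xs → length (f x) ≤ ℓ) → length (concatMap f xs) ≤ length xs * ℓ
length-concatMap f []       _  = z≤n
length-concatMap f (x ∷ xs) f≤ = ℕ.≤-trans (ℕ.≤-reflexive (length-++ (f x)))
  (ℕ.+-mono-≤ (f≤ (here refl)) (length-concatMap f xs (f≤ ∘ there)))

∷-unique : {A : Set} {x : A} {xs : List A} → ¬ (x ListMem.∈ xs) → Unique xs → Unique (x ∷ xs)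
∷-unique x∉ xs! = ¬Any⇒All¬ _ x∉ ∷ xs!

-- Applied with p = mc, q a power of 2mc, and a the size of the next family; the `suc` is the member
-- that may be lost, and the factor 2 makes up for it.
halving : ∀ p .{{_ : NonZero p}} {q a} → 1 ≤ q → (2 * p) * q ≤ p * suc a → q ≤ a
halving p {q} {a} 1≤q h = ℕ.+-cancelˡ-≤ 1 q a (begin
  1 + q      ≤⟨ ℕ.+-monoˡ-≤ q 1≤q ⟩
  q + q      ≡⟨ cong (q +_) (ℕ.+-identityʳ q) ⟨
  2 * q      ≤⟨ ℕ.*-cancelˡ-≤ p (ℕ.≤-trans (ℕ.≤-reflexive rearrange) h) ⟩
  suc a      ∎)
  where
  open ℕ.≤-Reasoning
  rearrange : p * (2 * q) ≡ 2 * p * q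
  rearrange = trans (sym (ℕ.*-assoc p 2 q)) (cong (_* q) (ℕ.*-comm p 2))

module Search (ℝ : Reals) (W : List (ℕ × ℕ)) (K : List ℕ) (K! : Unique K)
  (W⊆K : ∀ {y x} → (y , x) ListMem.∈ W → y ListMem.∈ K)
  (W-refl : ∀ {x} → x ListMem.∈ K → (x , x) ListMem.∈ W) where

  open Semantics ℝ
  open Spec ℝ

  W? : ∀ y x → Dec ((y , x) ListMem.∈ W)
  W? y x = DecMem._∈?_ (≡-dec ℕ._≟_ ℕ._≟_) (y , x) W

  near : ℕ → List ℕ
  near x = filter (λ y → W? y x) K

  ∈-near⁺ : ∀ {y x} → (y , x) ListMem.∈ W → y ListMem.∈ near x
  ∈-near⁺ yx∈ = ∈-filter⁺ (λ y → W? y _) (W⊆K yx∈) yx∈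

  chosenEnv : (S A : List ℕ) → Env (list (nat ⊗ nat) ∷ list nat ∷ list nat ∷ [])
  chosenEnv S A = W ∷ S ∷ A ∷ []

  chosen : (S A : List ℕ) → List ℕ
  chosen S A = value (greedy x₀ x₁ x₂) (chosenEnv S A)

  chosen-reflects : ∀ S A x (ys : List ℕ) → Reflects (Any (Conflict W S x) ys)
    (value (some (var x₁) (conflict (↑4 x₀) (↑4 x₁) x₂ x₀))
      (_∷_ {x = nat} x (_∷_ {x = list nat} ys (chosenEnv S A))))
  chosen-reflects S A x ys = some-reflects (λ z b → conflict-reflects
    (_∷_ {x = nat} z (_∷_ {x = bool} b (_∷_ {x = nat} x (_∷_ {x = list nat} ys (chosenEnv S A)))))
      (↑4 x₀) (↑4 x₁) x₂ x₀) ys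

  chosen-⊑ : ∀ S A → chosen S A ⊑ A
  chosen-⊑ S A = selecting-⊑ _ A

  chosen-maximal : ∀ S A {x} → x ListMem.∈ A → x ListMem.∈ chosen S A ⊎ Any (Conflict W S x) (chosen S A)
  chosen-maximal S A = selecting-maximal (chosen-reflects S A) A

  chosen-allPairs : ∀ S A → AllPairs (λ x y → ¬ Conflict W S x y) (chosen S A)
  chosen-allPairs S A = selecting-allPairs (chosen-reflects S A) A

  refinedEnv : (A : List ℕ) (y : ℕ) → Env (list (nat ⊗ nat) ∷ list nat ∷ nat ∷ [])
  refinedEnv A y = W ∷ A ∷ y ∷ []

  refined : List ℕ → ℕ → List ℕ
  refined A y = value (refine x₀ x₁ x₂) (refinedEnv A y)

  refined-reflects : ∀ A y x (ys : List ℕ) → Reflects (¬ x ≡ y × (y , x) ListMem.∈ W) _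
  refined-reflects A y x ys = and-reflects (not-reflects (=-reflects x y))
    (related-reflects (_∷_ {x = nat} x (_∷_ {x = list nat} ys (refinedEnv A y))) (↑2 x₂) x₀ (↑2 x₀))

  ∈-refined⁺ : ∀ {A y x} → x ListMem.∈ A → ¬ x ≡ y → (y , x) ListMem.∈ W → x ListMem.∈ refined A y
  ∈-refined⁺ {A} {y} x∈ x≢y yx∈ = proj₂ (∈-collecting⁺ (refined-reflects A y) x∈ (x≢y , yx∈))

  ∈-refined⁻ : ∀ {A y x} → x ListMem.∈ refined A y → ¬ x ≡ y × (y , x) ListMem.∈ W
  ∈-refined⁻ {A} {y} x∈ with _ , _ , _ , P , refl ← ∈-collecting⁻ (refined-reflects A y) A x∈ = P

  refined-⊑ : ∀ A y → refined A y ⊑ A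
  refined-⊑ A y = selecting-⊑ _ A

  insertedEnv : (S : List ℕ) (y : ℕ) → Env (list nat ∷ list nat ∷ nat ∷ [])
  insertedEnv S y = K ∷ S ∷ y ∷ []

  inserted : List ℕ → ℕ → List ℕ
  inserted S y = value (insert x₀ x₁ x₂) (insertedEnv S y)

  inserted-reflects : ∀ S y x (ys : List ℕ) → Reflects (x ≡ y ⊎ x ListMem.∈ S) _
  inserted-reflects S y x ys = or-reflects (=-reflects x y)
    (member-reflects (_∷_ {x = nat} x (_∷_ {x = list nat} ys (insertedEnv S y))) x₀ (↑2 x₁))

  ∈-inserted⁺ : ∀ {S y x} → x ListMem.∈ K → x ≡ y ⊎ x ListMem.∈ S → x ListMem.∈ inserted S y
  ∈-inserted⁺ {S} {y} x∈ P = proj₂ (∈-collecting⁺ (inserted-reflects S y) x∈ P)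

  ∈-inserted⁻ : ∀ {S y x} → x ListMem.∈ inserted S y → x ≡ y ⊎ x ListMem.∈ S
  ∈-inserted⁻ {S} {y} x∈ with _ , _ , _ , P , refl ← ∈-collecting⁻ (inserted-reflects S y) K x∈ = P

  inserted-⊑ : ∀ S y → inserted S y ⊑ K
  inserted-⊑ S y = selecting-⊑ _ K

  module _ (S A : List ℕ) where

    compared : ℕ → ℕ × List ℕ → ℕ × List ℕ
    compared y s = value (better x₀ x₁ x₂ x₃ (↑4 x₀))
      (_∷_ {x = list (nat ⊗ nat)} W (_∷_ {x = list nat} S (_∷_ {x = list nat} A
      (_∷_ {x = nat} y (_∷_ {x = nat ⊗ list nat} s [])))))

    optimum : List ℕ → ℕ × List ℕ
    optimum = foldr compared (0 , [])

    compared-reflects : ∀ y s → Reflects (¬ (y ListMem.∈ S) × length (proj₂ s) ≤ length (refined A y)) _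
    compared-reflects y s = and-reflects (not-reflects (member-reflects ρ (↑4 x₀) x₂))
      (subst₂ (λ a b → Reflects (a ≤ b) (does (value (size (snd (var (↑5 x₀)))) ρ ℕ.≤? value (size (var x₀)) ρ)))
        (size-length ρ (snd (var (↑5 x₀)))) (size-length ρ (var x₀)) (proof (_ ℕ.≤? _)))
      where
      ρ : Env (list nat ∷ list (nat ⊗ nat) ∷ list nat ∷ list nat ∷ nat ∷ (nat ⊗ list nat) ∷ [])
      ρ = refined A y ∷ W ∷ S ∷ A ∷ y ∷ s ∷ []

    data Comparison (y : ℕ) (s : ℕ × List ℕ) : ℕ × List ℕ → Set where
      replace : ¬ (y ListMem.∈ S) → length (proj₂ s) ≤ length (refined A y) → Comparison y s (y , refined A y)
      keep    : (¬ (y ListMem.∈ S) → length (refined A y) ≤ length (proj₂ s)) → Comparison y s s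

    comparison : ∀ y s → Comparison y s (compared y s)
    comparison y s = go (compared-reflects y s)
      where
      go : ∀ {b} → Reflects (¬ (y ListMem.∈ S) × length (proj₂ s) ≤ length (refined A y)) b →
           Comparison y s (if b then (y , refined A y) else s)
      go (ofʸ (y∉ , len)) = replace y∉ len
      go (ofⁿ ¬both)      = keep λ y∉ → ℕ.≰⇒≥ λ len → ¬both (y∉ , len)

    record Optimal (ys : List ℕ) (s : ℕ × List ℕ) : Set where
      field
        valid   : proj₂ s ≡ [] ⊎ (proj₁ s ListMem.∈ ys × ¬ (proj₁ s ListMem.∈ S) × proj₂ s ≡ refined A (proj₁ s))
        maximal : ∀ {y} → y ListMem.∈ ys → ¬ (y ListMem.∈ S) → length (refined A y) ≤ length (proj₂ s)
    open Optimal

    optimum-optimal : ∀ ys → Optimal ys (optimum ys)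
    optimum-optimal []       = record { valid = inj₁ refl ; maximal = λ () }
    optimum-optimal (y ∷ ys) with optimum ys | optimum-optimal ys
    ... | s | o with compared y s | comparison y s
    ... | _ | replace y∉ len = record
      { valid   = inj₂ (here refl , y∉ , refl)
      ; maximal = λ { (here refl) _ → ℕ.≤-refl ; (there z∈) z∉ → ℕ.≤-trans (o .maximal z∈ z∉) len } }
    ... | _ | keep len = record
      { valid   = Sum.map₂ (Product.map₁ there) (o .valid)
      ; maximal = λ { (here refl) y∉ → len y∉ ; (there z∈) z∉ → o .maximal z∈ z∉ } }

  module Loop (m c : ℕ) (0<c : 0 < c) (near-small : ∀ {x} → x ListMem.∈ K → length (near x) ≤ c) where

    -- `x` is near itself but not in `S`, so `x ∷ S` consists of distinct parts near `x`.
    S<near : ∀ {S : List ℕ} {x} → S ⊑ K → x ListMem.∈ K → ¬ (x ListMem.∈ S) →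
      (∀ {y} → y ListMem.∈ S → (y , x) ListMem.∈ W) → length S < length (near x)
    S<near S⊑K x∈K x∉S S⊆near = unique-⊆⇒length≤ (∷-unique x∉S (Unique-resp-⊒ S⊑K K!))
      λ { (here refl) → ∈-near⁺ (W-refl x∈K) ; (there y∈) → ∈-near⁺ (S⊆near y∈) }

    -- If the greedy family is small, the members of A all meet the few parts
    -- near it that lie outside S, so one such part is near to many of them.
    popular : ∀ S A → Unique A → A ⊑ K → (∀ {x} → x ListMem.∈ A → ¬ (x ListMem.∈ S)) → length (chosen S A) ≤ m →
              length A ≤ (m * c) * suc (length (proj₂ (optimum S A K)))
    popular S A A! A⊑K disjoint B≤m = begin
      length A                  ≤⟨ pigeonhole W? A candidates cover few ⟩
      length candidates * suc ℓ ≤⟨ ℕ.*-monoˡ-≤ (suc ℓ)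
        (ℕ.≤-trans (length-concatMap outer B outer-small) (ℕ.*-monoˡ-≤ c B≤m)) ⟩
      m * c * suc ℓ             ∎
      where
      open ℕ.≤-Reasoning
      B = chosen S A
      ℓ = length (proj₂ (optimum S A K))
      ∉S? : ∀ y → Dec (¬ (y ListMem.∈ S))
      ∉S? y = ¬? (DecMem._∈?_ ℕ._≟_ y S)
      outer : ℕ → List ℕ
      outer x = filter ∉S? (near x)
      candidates = concatMap outer B
      outer-small : ∀ {x} → x ListMem.∈ B → length (outer x) ≤ c
      outer-small x∈B = ℕ.≤-trans (length-mono-≤ (filter-⊆ ∉S? (near _)))
        (near-small (⊑-lookup A⊑K (⊑-lookup (chosen-⊑ S A) x∈B)))
      ∈-candidates : ∀ {x y} → x ListMem.∈ B → (y , x) ListMem.∈ W → ¬ (y ListMem.∈ S) → y ListMem.∈ candidates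
      ∈-candidates x∈B yx∈ y∉S = ∈-concatMap⁺ outer (ListMem.lose x∈B (∈-filter⁺ ∉S? (∈-near⁺ yx∈) y∉S))
      cover : ∀ {x} → x ListMem.∈ A → Any (λ y → (y , x) ListMem.∈ W) candidates
      cover x∈A with chosen-maximal S A x∈A
      -- A chosen `x` is covered by its own part, which is near it and, by disjointness, outside
      -- `S`.
      ... | inj₁ x∈B =
        let xx∈ = W-refl (⊑-lookup A⊑K x∈A)
        in ListMem.lose (∈-candidates x∈B xx∈ (disjoint x∈A)) xx∈
      ... | inj₂ conflicts
        with b , b∈B , clash yx∈ y∉S yb∈ ← ListMem.find conflicts =
        ListMem.lose (∈-candidates b∈B yb∈ y∉S) yx∈
      -- `refined` omits `y` itself; the `suc` allows for it.
      few : ∀ {y} → y ListMem.∈ candidates → length (filter (W? y) A) ≤ suc ℓ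
      few {y} y∈ with x , x∈B , y∈outer ← ListMem.find (∈-concatMap⁻ outer {xs = B} y∈)
                 with y∈near , y∉S ← ∈-filter⁻ ∉S? {xs = near x} y∈outer
                 with y∈K , _ ← ∈-filter⁻ (λ y → W? y x) {xs = K} y∈near =
        ℕ.≤-trans (unique-⊆⇒length≤ (unique-filter⁺ (W? y) A!) near⊆)
          (s≤s (optimum-optimal S A K .Optimal.maximal y∈K y∉S))
        where
        near⊆ : ∀ {z} → z ListMem.∈ filter (W? y) A → z ListMem.∈ y ∷ refined A y
        near⊆ {z} z∈ with z∈A , yz∈ ← ∈-filter⁻ (W? y) {xs = A} z∈ with z ℕ.≟ y
        ... | yes z≡y = here z≡y
        ... | no z≢y  = there (∈-refined⁺ z∈A z≢y yz∈)

    q = 2 * m * c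

    -- Each unsuccessful round spends one factor `q` of the size of `A` and adds a part to `S`; `j`
    -- is the exponent still in hand. `0<m` keeps the powers of `q` positive and hence `A` nonempty.
    record Active (i : ℕ) (S A : List ℕ) : Set where
      field
        {j}      : ℕ
        i+j      : i + j ≡ suc c
        large    : q ^ j ≤ length A
        i≤       : i ≤ length S
        0<m      : 0 < m
        S⊆near   : ∀ {x y} → x ListMem.∈ A → y ListMem.∈ S → (y , x) ListMem.∈ W

    Done : (S A : List ℕ) → Set
    Done S A = m ≤ length (chosen S A) × length S ≤ c

    record State (A₀ : List ℕ) (i : ℕ) (s : List ℕ × List ℕ) : Set where
      field
        S⊑K      : proj₁ s ⊑ K
        A⊑A₀     : proj₂ s ⊑ A₀
        disjoint : ∀ {x} → x ListMem.∈ proj₂ s → ¬ (x ListMem.∈ proj₁ s)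
        progress : Done (proj₁ s) (proj₂ s) ⊎ Active i (proj₁ s) (proj₂ s)

    improvedEnv : (S A : List ℕ) → Env (list (nat ⊗ nat) ∷ list nat ∷ nat ∷ list nat ∷ list nat ∷ [])
    improvedEnv S A = W ∷ K ∷ m ∷ S ∷ A ∷ []

    improved : List ℕ × List ℕ → List ℕ × List ℕ
    improved (S , A) = value (improve x₀ x₁ x₂ x₃ (↑4 x₀)) (improvedEnv S A)

    data Improvement (S A : List ℕ) : List ℕ × List ℕ → Set where
      finished : m ≤ length (chosen S A) → Improvement S A (S , A)
      advanced : length (chosen S A) < m →
                 Improvement S A (inserted S (proj₁ (optimum S A K)) , proj₂ (optimum S A K))

    improvement : ∀ S A → Improvement S A (improved (S , A))
    improvement S A = go (subst (λ b → Reflects (m ≤ b) (does (m ℕ.≤? value (size g) (improvedEnv S A))))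
                                (size-length (improvedEnv S A) g) (proof (m ℕ.≤? _)))
      where
      g = greedy x₀ x₃ (↑4 x₀)
      go : ∀ {b} → Reflects (m ≤ length (chosen S A)) b → Improvement S A
           (if b then (S , A) else (inserted S (proj₁ (optimum S A K)) , proj₂ (optimum S A K)))
      go (ofʸ m≤) = finished m≤
      go (ofⁿ m≰) = advanced (ℕ.≰⇒> m≰)

    q^j>0 : ∀ j → 0 < m → 0 < q ^ j
    q^j>0 j 0<m = ℕ.m^n>0 q {{ℕ.>-nonZero (ℕ.*-mono-< {0} {2 * m} (ℕ.*-mono-< {0} {2} (s≤s z≤n) 0<m) 0<c)}} j

    nonempty : {xs : List ℕ} → 0 < length xs → ∃ λ x → x ListMem.∈ xs
    nonempty {x ∷ _} _ = x , here refl

    module _ {A₀ : List ℕ} (A₀⊑K : A₀ ⊑ K) where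

      -- Two bounds on `near x` are played against this: at most `c` members, so the exponent does
      -- not run out, and at most as many as `K`, so the loop is long enough.
      active⇒S<near : ∀ {i s} → State A₀ i s → Active i (proj₁ s) (proj₂ s) →
                      ∃ λ x → x ListMem.∈ K × length (proj₁ s) < length (near x)
      active⇒S<near st a =
        let x , x∈A = nonempty (ℕ.<-≤-trans (q^j>0 (a .Active.j) (a .Active.0<m)) (a .Active.large))
            x∈K = ⊑-lookup (⊆-trans (st .State.A⊑A₀) A₀⊑K) x∈A
        in x , x∈K , S<near (st .State.S⊑K) x∈K (st .State.disjoint x∈A) (a .Active.S⊆near x∈A)

      active⇒S<c : ∀ {i s} → State A₀ i s → Active i (proj₁ s) (proj₂ s) → length (proj₁ s) < c
      active⇒S<c st a = let _ , x∈K , S< = active⇒S<near st a in ℕ.<-≤-trans S< (near-small x∈K)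

      improved-state : ∀ {i s} → State A₀ i s → State A₀ (suc i) (improved s)
      improved-state {i} {S , A} st with improved (S , A) | improvement S A
      ... | _ | finished m≤ = record
        { S⊑K = S⊑K ; A⊑A₀ = A⊑A₀ ; disjoint = disjoint
        ; progress = inj₁ (m≤ , Sum.[ proj₂ , (λ a → ℕ.<⇒≤ (active⇒S<c st a)) ] progress) }
        where open State st
      ... | _ | advanced B<m with st .State.progress
      -- A finished pair is a fixed point, because the same greedy family is computed again.
      ...   | inj₁ (m≤ , _) = contradiction m≤ (ℕ.<⇒≱ B<m)
      ...   | inj₂ a = advance-state (optimum-optimal S A K .Optimal.valid)
        where
        open State st
        open Active a
        y  = proj₁ (optimum S A K)
        A′ = proj₂ (optimum S A K)
        A⊑K = ⊆-trans A⊑A₀ A₀⊑K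
        large′ : ∃ λ j′ → suc i + j′ ≡ suc c × q ^ j′ ≤ length A′
        large′ with j | i+j | large
        -- No exponent left would mean c + 1 rounds and as many members of `S`, but `S` has fewer
        -- than c.
        ... | zero   | i+j | _ = contradiction
          (ℕ.≤-trans (ℕ.≤-reflexive (trans (sym i+j) (ℕ.+-identityʳ i))) i≤)
          (ℕ.<⇒≱ (ℕ.m<n⇒m<1+n (active⇒S<c st a)))
        ... | suc j′ | i+j | large = j′ , trans (sym (ℕ.+-suc i j′)) i+j ,
          halving (m * c) {{ℕ.>-nonZero (ℕ.*-mono-< 0<m 0<c)}} (q^j>0 j′ 0<m)
            (ℕ.≤-trans (ℕ.≤-reflexive (cong (_* q ^ j′) (sym (ℕ.*-assoc 2 m c))))
              (ℕ.≤-trans large (popular S A (Unique-resp-⊒ A⊑K K!) A⊑K disjoint (ℕ.<⇒≤ B<m))))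
        advance-state : A′ ≡ [] ⊎ (y ListMem.∈ K × ¬ (y ListMem.∈ S) × A′ ≡ refined A y) →
                        State A₀ (suc i) (inserted S y , A′)
        -- The placeholder of the fold cannot be the optimum, whose list has at least `q ^ j′` > 0
        -- members.
        advance-state (inj₁ A′≡[]) = contradiction
          (ℕ.<-≤-trans (q^j>0 (proj₁ large′) 0<m) (proj₂ (proj₂ large′)))
          (λ 0< → ℕ.<-irrefl (cong length (sym A′≡[])) 0<)
        advance-state (inj₂ (y∈K , y∉S , A′≡)) = record
          { S⊑K = inserted-⊑ S y
          ; A⊑A₀ = ⊆-trans A′⊑A A⊑A₀
          ; disjoint = λ x∈A′ x∈S′ →
              Sum.[ proj₁ (near-y x∈A′) , disjoint (⊑-lookup A′⊑A x∈A′) ] (∈-inserted⁻ {S} x∈S′)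
          ; progress = inj₂ record
            { i+j = proj₁ (proj₂ large′) ; large = proj₂ (proj₂ large′) ; 0<m = 0<m
            ; i≤ = ℕ.≤-trans (s≤s i≤) (unique-⊆⇒length≤ (∷-unique y∉S (Unique-resp-⊒ S⊑K K!)) S⊆S′)
            ; S⊆near = λ x∈A′ z∈S′ →
                Sum.[ (λ { refl → proj₂ (near-y x∈A′) }) , S⊆near (⊑-lookup A′⊑A x∈A′) ] (∈-inserted⁻ {S} z∈S′) } }
          where
          A′⊑A : A′ ⊑ A
          A′⊑A = subst (_⊑ A) (sym A′≡) (refined-⊑ A y)
          near-y : ∀ {x} → x ListMem.∈ A′ → ¬ x ≡ y × (y , x) ListMem.∈ W
          near-y x∈A′ = ∈-refined⁻ {A} (subst (_ ListMem.∈_) A′≡ x∈A′)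
          S⊆S′ : ∀ {z} → z ListMem.∈ y ∷ S → z ListMem.∈ inserted S y
          S⊆S′ (here refl) = ∈-inserted⁺ {S} y∈K (inj₁ refl)
          S⊆S′ (there z∈)  = ∈-inserted⁺ {S} (⊑-lookup S⊑K z∈) (inj₂ z∈)

      initial-state : q ^ suc c ≤ length A₀ → State A₀ 0 ([] , A₀)
      initial-state large = record
        { S⊑K = minimum K ; A⊑A₀ = ⊆-refl ; disjoint = λ _ () ; progress = start m refl }
        where
        start : ∀ m′ → m ≡ m′ → Done [] A₀ ⊎ Active 0 [] A₀
        -- For `m = 0` also `q = 0`, and the size of `A₀` says nothing; but then the empty `S`
        -- already succeeds.
        start zero    refl = inj₁ (z≤n , z≤n)
        start (suc _) refl = inj₂ record { i+j = refl ; large = large ; i≤ = z≤n ; 0<m = s≤s z≤n ; S⊆near = λ _ () }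

      searchEnv : Env (list (nat ⊗ nat) ∷ list nat ∷ list nat ∷ nat ∷ [])
      searchEnv = W ∷ K ∷ A₀ ∷ m ∷ []

      found : List ℕ × List ℕ
      found = value (search x₀ x₁ x₂ x₃) searchEnv

      found-done : q ^ suc c ≤ length A₀ → State A₀ (length K) found × Done (proj₁ found) (proj₂ found)
      found-done large with st ← foldr-counts {f = improved} (State A₀) K (initial-state large) improved-state
        with st .State.progress
      ... | inj₁ done = st , done
      ... | inj₂ a with x , _ , S< ← active⇒S<near st a =
        contradiction (a .Active.i≤) (ℕ.<⇒≱ (ℕ.<-≤-trans S< (length-mono-≤ (filter-⊆ (λ y → W? y x) K))))

-- The list of parts, and the size of the encoded input.

length-cartesianProduct : {A B : Set} (xs : List A) (ys : List B) →
                          length (cartesianProduct xs ys) ≡ length xs * length ys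
length-cartesianProduct []       ys = refl
length-cartesianProduct (x ∷ xs) ys = trans (length-++ (map (x ,_) ys))
  (cong₂ _+_ (length-map (x ,_) ys) (length-cartesianProduct xs ys))

∈-indices⁺ : ∀ {n} {p : Subset n} {i} → i ∈ p → toℕ i ListMem.∈ map toℕ (elements p)
∈-indices⁺ = ∈-map⁺ toℕ ∘ ∈-elements⁺

∈-indices⁻ : ∀ {n} {p : Subset n} {i} → toℕ i ListMem.∈ map toℕ (elements p) → i ∈ p
∈-indices⁻ i∈ with j , j∈ , i≡j ← ∈-map⁻ toℕ i∈ with refl ← toℕ-injective i≡j = ∈-elements⁻ j∈

module Diagonal (ℝ : Reals) {k : ℕ} {R : Rel (Fin k) 0ℓ}
  (R? : ∀ i j → Dec (R i j)) (R-refl : ∀ {i} → R i i) where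
  open Semantics ℝ

  private
    keep : ℕ × ℕ → List ℕ → List ℕ
    keep (i , j) xs = if i ≡ᵇ j then i ∷ xs else xs

    code : List (Fin k × Fin k) → List (ℕ × ℕ)
    code = map (λ (i , j) → toℕ i , toℕ j) ∘ filter (λ (i , j) → R? i j)

    keep-≡ : ∀ i xs → keep (i , i) xs ≡ i ∷ xs
    keep-≡ i xs with i ≡ᵇ i | =-reflects i i
    ... | _ | ofʸ _  = refl
    ... | _ | ofⁿ i≢ = contradiction refl i≢

    keep-≢ : ∀ {i j} xs → i ≢ j → keep (i , j) xs ≡ xs
    keep-≢ {i} {j} xs i≢j with i ≡ᵇ j | =-reflects i j
    ... | _ | ofʸ i≡j = contradiction i≡j i≢j
    ... | _ | ofⁿ _   = refl

    row-∉ : ∀ {i} acc js → ¬ (i ListMem.∈ js) → foldr keep acc (code (map (i ,_) js)) ≡ acc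
    row-∉ acc []       _  = refl
    row-∉ {i} acc (j ∷ js) i∉ with R? i j
    ... | yes _ = trans (keep-≢ _ (i∉ ∘ here ∘ toℕ-injective)) (row-∉ acc js (i∉ ∘ there))
    ... | no _  = row-∉ acc js (i∉ ∘ there)

    row-∈ : ∀ {i} acc js → Unique js → i ListMem.∈ js → foldr keep acc (code (map (i ,_) js)) ≡ toℕ i ∷ acc
    row-∈ {i} acc (j ∷ js) (j∉ ∷ _) (here refl) with R? i i
    ... | yes _ = trans (keep-≡ (toℕ i) _) (cong (toℕ i ∷_) (row-∉ acc js (λ i∈ → All.lookup j∉ i∈ refl)))
    ... | no ¬R = contradiction R-refl ¬R
    row-∈ {i} acc (j ∷ js) (j∉ ∷ js!) (there i∈) with R? i j
    ... | yes _ = trans (keep-≢ _ (λ i≡j → All.lookup j∉ i∈ (sym (toℕ-injective i≡j)))) (row-∈ acc js js! i∈)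
    ... | no _  = row-∈ acc js js! i∈

    -- The product is listed row by row, and by reflexivity the row of `i` contains its diagonal
    -- pair, exactly once.
    rows : ∀ is → foldr keep [] (code (cartesianProduct is (allFin k))) ≡ map toℕ is
    rows []       = refl
    rows (i ∷ is) = begin
      foldr keep [] (code (map (i ,_) (allFin k) ++ cartesianProduct is (allFin k)))
        ≡⟨ cong (foldr keep [] ∘ map _) (filter-++ (λ (i , j) → R? i j) (map (i ,_) (allFin k)) _) ⟩
      foldr keep [] (map _ (filter _ (map (i ,_) (allFin k)) ++ filter _ (cartesianProduct is (allFin k))))
        ≡⟨ cong (foldr keep []) (map-++ _ (filter _ (map (i ,_) (allFin k))) _) ⟩
      foldr keep [] (code (map (i ,_) (allFin k)) ++ code (cartesianProduct is (allFin k)))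
        ≡⟨ foldr-++ keep [] (code (map (i ,_) (allFin k))) _ ⟩
      foldr keep (foldr keep [] (code (cartesianProduct is (allFin k)))) (code (map (i ,_) (allFin k)))
        ≡⟨ row-∈ _ (allFin k) (allFin⁺ k) (∈-allFin i) ⟩
      toℕ i ∷ foldr keep [] (code (cartesianProduct is (allFin k)))
        ≡⟨ cong (toℕ i ∷_) (rows is) ⟩
      toℕ i ∷ map toℕ is ∎
      where open ≡-Reasoning

  -- Equality of lists, because sublists of `K` are to be recognised as `indices` of subsets.
  diagonal-encodeRel : value (diagonal x₀) (encodeRel R? ∷ []) ≡ map toℕ (allFin k)
  diagonal-encodeRel = rows (allFin k)

module Encoding (ℝ : Reals) where
  open Semantics ℝ
  open Graphs ℝ using (WeightedGraph)
  open Cost ℝ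

  parts≤ : ∀ {n k} → Partition n k → k ≤ n
  parts≤ 𝒫 = injective⇒≤ {f = λ X → proj₁ (surjective X)} λ {X} {Y} eq →
    trans (sym (proj₂ (surjective X))) (trans (cong part eq) (proj₂ (surjective Y)))
    where open Partition 𝒫

  filtered≤ : ∀ {m n N} {B : Set} {P : Fin m × Fin n → Set}
              (P? : ∀ x → Dec (P x)) (f : Fin m × Fin n → B) →
              m * n ≤ N →
              length (map f (filter P? (cartesianProduct (allFin m) (allFin n)))) ≤ N
  filtered≤ {m} {n} {N} P? f mn≤N = begin
    length (map f (filter P? all-pairs))  ≡⟨ length-map f (filter P? all-pairs) ⟩
    length (filter P? all-pairs)          ≤⟨ length-filter P? all-pairs ⟩
    length all-pairs                      ≡⟨ length-cartesianProduct (allFin m) (allFin n) ⟩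
    length (allFin m) * length (allFin n) ≡⟨ cong₂ _*_ (length-tabulate {n = m} id) (length-tabulate {n = n} id) ⟩
    m * n                                 ≤⟨ mn≤N ⟩
    N                                     ∎
    where
    open ℕ.≤-Reasoning
    all-pairs = cartesianProduct (allFin m) (allFin n)

  -- Parts are nonempty, so there are at most `n` of them, and every relation in the input has at
  -- most `n ^ 2` pairs.
  encode-small : ∀ {n k} .{{_ : NonZero n}} (G : WeightedGraph n) r (𝒫 : Partition n k)
                 {_⪯_ : Rel (Fin k) 0ℓ} (⪯-ord : IsDecTotalOrder _≡_ _⪯_) m A →
                 SmallEnv (n ^ 2) (encode G r 𝒫 ⪯-ord m A)
  encode-small {n} {k} G r 𝒫 ⪯-ord m A =
    tt ∷ˢ (filtered≤ (λ (u , v) → WeightedGraph.adj? G u v) _ (nn≤ ℕ.≤-refl ℕ.≤-refl) , All.universal _ _) ∷ˢ tt ∷ˢ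
    tt ∷ˢ (filtered≤ (λ (v , X) → Partition.part 𝒫 v ≟ X) _ (nn≤ ℕ.≤-refl k≤n) , All.universal _ _) ∷ˢ
    (filtered≤ (λ (X , Y) → IsDecTotalOrder._≤?_ ⪯-ord X Y) _ (nn≤ k≤n k≤n) , All.universal _ _) ∷ˢ tt ∷ˢ
    (A≤ , All.universal _ _) ∷ˢ λ ()
    where
    k≤n = parts≤ 𝒫
    nn≤ : ∀ {a b} → a ≤ n → b ≤ n → a * b ≤ n ^ 2
    nn≤ a≤n b≤n = ℕ.*-mono-≤ a≤n (ℕ.≤-trans b≤n (ℕ.≤-reflexive (sym (ℕ.*-identityʳ n))))
    A≤ : length (indices A) ≤ n ^ 2
    A≤ = ℕ.≤-trans (ℕ.≤-reflexive (length-map toℕ (elements A))) (ℕ.≤-trans (length-filter (_∈? A) (allFin k))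
      (ℕ.≤-trans (ℕ.≤-reflexive (length-tabulate {n = k} id)) (ℕ.≤-trans k≤n (ℕ.m≤m*n n (n ^ 1) {{ℕ.m^n≢0 n 1}}))))

-- From disjoint near parts to distance.

module Separation (ℝ : Reals) {n k : ℕ} (G : Graphs.WeightedGraph ℝ n) (𝒫 : Partition n k)
  {_⪯_ : Rel (Fin k) 0ℓ} (⪯-ord : IsDecTotalOrder _≡_ _⪯_) {r : Reals.Carrier ℝ} where
  open Reals ℝ using (Carrier; _<⁺_; ≤⁺-totalOrder)
  open RealProperties ℝ using (≰⇒>)
  open Graphs ℝ hiding (length)
  open PathProperties ℝ G
  open Partition 𝒫

  private
    ends : (X₁ X₂ : Fin k) → List (Fin n × Fin n)
    ends X₁ X₂ = cartesianProduct (elements (block X₁)) (elements (block X₂))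

    lengths : Subset n → Fin n × Fin n → List (Carrier ⁺)
    lengths U (x , y) = List.map [_] (pathLengths G U x y)

  -- The minimum in `dist` is either its default `⊤⁺` or the length of an actual path, to which
  -- `meeting-part` applies.
  disjoint⇒distant : ∀ {S X₁ X₂} →
    (∀ {Y} → Y ∉ S → WeaklyReachable G 𝒫 ⪯-ord r X₁ Y → ¬ WeaklyReachable G 𝒫 ⪯-ord r X₂ Y) →
    [ r ] <⁺ dist G (∁ (⋃ S)) (block X₁) (block X₂)
  disjoint⇒distant {S} {X₁} {X₂} apart
    with Data.List.Extrema.argmin-sel ≤⁺-totalOrder id ⊤⁺ (List.concatMap (lengths (∁ (⋃ S))) (ends X₁ X₂))
  ... | inj₁ ≡⊤ = subst ([ r ] <⁺_) (sym ≡⊤) AddSupStrict.[ r ]<⊤⁺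
  ... | inj₂ ∈lengths
    with (x , y) , xy∈ , ℓ∈ ← ListMem.find (∈-concatMap⁻ (lengths (∁ (⋃ S))) {xs = ends X₁ X₂} ∈lengths)
    with ℓ , ℓ∈ , ≡ℓ ← ∈-map⁻ [_] ℓ∈
    with p , refl ← pathLengths-sound G ℓ∈
    with x∈ , y∈ ← ∈-cartesianProduct⁻ (elements (block X₁)) (elements (block X₂)) xy∈
    with refl ← ∈-comprehension⁻ (λ v → part v ≟ X₁) (∈-elements⁻ x∈)
    with refl ← ∈-comprehension⁻ (λ v → part v ≟ X₂) (∈-elements⁻ y∈) =
    subst ([ r ] <⁺_) (sym ≡ℓ) AddSupStrict.[ ≰⇒> (λ p≤r →
      let _ , Y∉S , w₁ , w₂ = meeting-part 𝒫 ⪯-ord p p≤r in apart Y∉S w₁ w₂) ]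

-- Correctness

module Correctness (ℝ : Reals) {n k : ℕ} .{{_ : NonZero n}} (G : Graphs.WeightedGraph ℝ n)
  (r : Reals.Carrier ℝ) (0<r : Reals._<_ ℝ (Reals.0# ℝ) r) (𝒫 : Partition n k)
  {_⪯_ : Rel (Fin k) 0ℓ} (⪯-ord : IsDecTotalOrder _≡_ _⪯_) (m : ℕ) (A : Subset k) where
  private module R = Reals ℝ
  open Graphs ℝ using (WeaklyReachable; weaklyReachable?; WReach; wcol; dist)
  open Semantics ℝ
  open BellmanFord ℝ
  open Spec ℝ using (Conflict; clash)
  open PathProperties ℝ G using (weaklyReachable-refl)
  open Partition 𝒫 using (part; block; ⋃)

  c = wcol G 𝒫 ⪯-ord r
  input = encode G r 𝒫 ⪯-ord m A

  W = pairs G 𝒫 ⪯-ord r 0<r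

  K : List ℕ
  K = value (diagonal x₀) (encodeRel (IsDecTotalOrder._≤?_ ⪯-ord) ∷ [])

  K≡ : K ≡ map toℕ (allFin k)
  K≡ = Diagonal.diagonal-encodeRel ℝ (IsDecTotalOrder._≤?_ ⪯-ord) (IsDecTotalOrder.refl ⪯-ord)

  K! : Unique K
  K! = subst Unique (sym K≡) (unique-map⁺ toℕ-injective (allFin⁺ k))

  ∈K : ∀ X → toℕ X ListMem.∈ K
  ∈K X = subst (toℕ X ListMem.∈_) (sym K≡) (∈-map⁺ toℕ (∈-allFin X))

  W⊆K : ∀ {y x} → (y , x) ListMem.∈ W → y ListMem.∈ K
  W⊆K yx∈ with Y , _ , refl , _ , _ ← ∈-pairs⁻ G 𝒫 ⪯-ord r 0<r yx∈ = ∈K Y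

  W-refl : ∀ {x} → x ListMem.∈ K → (x , x) ListMem.∈ W
  W-refl x∈ with X , _ , refl ← ∈-map⁻ toℕ (subst (_ ListMem.∈_) K≡ x∈) =
    ∈-pairs⁺ G 𝒫 ⪯-ord r 0<r (weaklyReachable-refl 𝒫 ⪯-ord (proj₁ 0<r) X)

  open Search ℝ W K K! W⊆K W-refl

  subset : ∀ {xs} → xs ⊑ K → ∃ λ p → xs ≡ indices p
  subset {xs} xs⊑K = sublist-indices toℕ (subst (xs ⊑_) K≡ xs⊑K)

  length-indices : ∀ (p : Subset k) → length (indices p) ≡ ∣ p ∣
  length-indices p = trans (length-map toℕ (elements p)) (length-elements p)

  WReach≤c : ∀ X → ∣ WReach G 𝒫 ⪯-ord r X ∣ ≤ c
  WReach≤c X = All.lookup (Extremaℕ.xs≤max 0 _) (∈-map⁺ (λ X → ∣ WReach G 𝒫 ⪯-ord r X ∣) (∈-allFin X))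

  near-small : ∀ {x} → x ListMem.∈ K → length (near x) ≤ c
  near-small {x} x∈ with X , _ , refl ← ∈-map⁻ toℕ (subst (_ ListMem.∈_) K≡ x∈)
    with p , near≡ ← subset (filter-⊆ (λ y → W? y (toℕ X)) K) = begin
      length (near (toℕ X))      ≡⟨ cong length near≡ ⟩
      length (indices p)         ≡⟨ length-indices p ⟩
      ∣ p ∣                      ≤⟨ p⊆q⇒∣p∣≤∣q∣ p⊆WReach ⟩
      ∣ WReach G 𝒫 ⪯-ord r X ∣   ≤⟨ WReach≤c X ⟩
      c                          ∎
    where
    open ℕ.≤-Reasoning
    p⊆WReach : p ⊆ WReach G 𝒫 ⪯-ord r X
    p⊆WReach {Y} Y∈p
      with _ , yx∈ ← ∈-filter⁻ (λ y → W? y (toℕ X)) {xs = K}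
           (subst (toℕ Y ListMem.∈_) (sym near≡) (∈-indices⁺ Y∈p))
      with _ , _ , Y≡ , X≡ , w ← ∈-pairs⁻ G 𝒫 ⪯-ord r 0<r yx∈
      with refl ← toℕ-injective Y≡ | refl ← toℕ-injective X≡ =
      ∈-comprehension⁺ (weaklyReachable? G 𝒫 ⪯-ord r X) w

  -- There is a vertex, and its part is weakly reachable from itself. Thus `q` is positive whenever
  -- `m` is.
  0<c : 0 < c
  0<c = ℕ.<-≤-trans (ℕ.≤-<-trans z≤n (x∈p⇒∣p-x∣<∣p∣ X∈)) (WReach≤c X)
    where
    X  = part (someVertex n)
      where
      someVertex : ∀ n .{{_ : NonZero n}} → Fin n
      someVertex (suc _) = zero
    X∈ = ∈-comprehension⁺ (weaklyReachable? G 𝒫 ⪯-ord r X) (weaklyReachable-refl 𝒫 ⪯-ord (proj₁ 0<r) X)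

  A⊑K : indices A ⊑ K
  A⊑K = subst (indices A ⊑_) (sym K≡) (⊑-map⁺ toℕ (filter-⊆ (_∈? A) (allFin k)))

  open Loop m c 0<c near-small

  Result : Set
  Result =
    ∃₂ λ (S B : Subset k) →
      value algorithm input ≡ (indices S , indices B) ×
      B ⊆ A ─ S ×
      ∣ S ∣ ≤ c ×
      ∣ B ∣ ≥ m ×
      (∀ {X₁ X₂} → X₁ ∈ B → X₂ ∈ B → X₁ ≢ X₂ →
        [ r ] R.<⁺ dist G (∁ (⋃ S)) (block X₁) (block X₂))

  done⇒result : ∀ {i S′ A′} → value algorithm input ≡ (S′ , chosen S′ A′) →
                State (indices A) i (S′ , A′) → Done S′ A′ → Result
  done⇒result {S′ = S′} {A′} computed st (m≤B , S≤c) =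
    S , B , trans computed (cong₂ _,_ S≡ B≡) , B⊆A─S
    , subst (_≤ c) (trans (cong length S≡) (length-indices S)) S≤c
    , subst (m ≤_) (trans (cong length B≡) (length-indices B)) m≤B
    , λ X₁∈B X₂∈B X₁≢X₂ → Separation.disjoint⇒distant ℝ G 𝒫 ⪯-ord
        (apart (allPairs-total (chosen-allPairs S′ A′) (∈B X₁∈B) (∈B X₂∈B) (X₁≢X₂ ∘ toℕ-injective)))
    where
    S  = proj₁ (subset (State.S⊑K st))
    S≡ = proj₂ (subset (State.S⊑K st))
    B⊑K = ⊆-trans (chosen-⊑ S′ A′) (⊆-trans (State.A⊑A₀ st) A⊑K)
    B  = proj₁ (subset B⊑K)
    B≡ = proj₂ (subset B⊑K)
    ∈B : ∀ {X} → X ∈ B → toℕ X ListMem.∈ chosen S′ A′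
    ∈B {X} X∈B = subst (toℕ X ListMem.∈_) (sym B≡) (∈-indices⁺ X∈B)
    B⊆A─S : B ⊆ A ─ S
    B⊆A─S {X} X∈B = x∈p∧x∉q⇒x∈p─q (∈-indices⁻ (⊑-lookup (State.A⊑A₀ st) X∈A′))
      λ X∈S → State.disjoint st X∈A′ (subst (toℕ X ListMem.∈_) (sym S≡) (∈-indices⁺ X∈S))
      where X∈A′ = ⊑-lookup (chosen-⊑ S′ A′) (∈B X∈B)
    apart : ∀ {X₁ X₂} → ¬ Conflict W S′ (toℕ X₁) (toℕ X₂) ⊎ ¬ Conflict W S′ (toℕ X₂) (toℕ X₁) →
            ∀ {Y} → Y ∉ S → WeaklyReachable G 𝒫 ⪯-ord r X₁ Y → ¬ WeaklyReachable G 𝒫 ⪯-ord r X₂ Y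
    apart ¬clash {Y} Y∉S w₁ w₂ = Sum.[ (λ ¬c → ¬c (clash y₁ y∉S′ y₂)) , (λ ¬c → ¬c (clash y₂ y∉S′ y₁)) ] ¬clash
      where
      y∉S′ : ¬ (toℕ Y ListMem.∈ S′)
      y∉S′ y∈ = Y∉S (∈-indices⁻ (subst (toℕ Y ListMem.∈_) S≡ y∈))
      y₁ = ∈-pairs⁺ G 𝒫 ⪯-ord r 0<r w₁
      y₂ = ∈-pairs⁺ G 𝒫 ⪯-ord r 0<r w₂

  -- Since subprograms refer to their inputs by variables and are never weakened, their values under
  -- the nested `let′` agree by computation with those in the small environments used above.
  value-algorithm : value algorithm input ≡ (proj₁ (found A⊑K) , chosen (proj₁ (found A⊑K)) (proj₂ (found A⊑K)))
  value-algorithm = refl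

  solution : ∣ A ∣ ≥ (2 * m * c) ^ (c + 1) → Result
  solution large = done⇒result value-algorithm (proj₁ done) (proj₂ done)
    where
    done = found-done A⊑K (begin
      (2 * m * c) ^ suc c    ≡⟨ cong ((2 * m * c) ^_) (ℕ.+-comm 1 c) ⟩
      (2 * m * c) ^ (c + 1)  ≤⟨ large ⟩
      ∣ A ∣                  ≡⟨ length-indices A ⟨
      length (indices A)     ∎)
      where open ℕ.≤-Reasoning

-- The polynomial time bound.

module Complexity (ℝ : Reals) where
  open Cost ℝ

  polynomial : Polynomial algorithm
  -- This type-checks because `polynomial?` evaluates to `just` on the algorithm; the analysis is
  -- carried out by normalisation.
  polynomial = from-just (polynomial? algorithm)

theorem1p10 :
    (ℝ : Reals) →
    let module R = Reals ℝ
        open Graphs ℝ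
        open Semantics ℝ
    in
    ∃ λ (alg : Program Input (list nat ⊗ list nat)) →
    ∃₂ λ (C d : ℕ) →
    ∀ {n k : ℕ} .{{_ : NonZero n}}
      (G : WeightedGraph n) (r : R.Carrier) → R.0# R.< r →
      (𝒫 : Partition n k)
      {_⪯_ : Rel (Fin k) 0ℓ} (⪯-ord : IsDecTotalOrder _≡_ _⪯_)
      (m : ℕ) (A : Subset k) →
    let c     = wcol G 𝒫 ⪯-ord r
        input = encode G r 𝒫 ⪯-ord m A
    in
    ∣ A ∣ ≥ (2 * m * c) ^ (c + 1) →
    cost alg input ≤ C * n ^ d ×
    ∃₂ λ (S B : Subset k) →
      value alg input ≡ (indices S , indices B) ×
      B ⊆ A ─ S ×
      ∣ S ∣ ≤ c ×
      ∣ B ∣ ≥ m ×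
      (∀ {X₁ X₂} → X₁ ∈ B → X₂ ∈ B → X₁ ≢ X₂ →
        [ r ] R.<⁺ dist G (∁ (Partition.⋃ 𝒫 S)) (Partition.block 𝒫 X₁) (Partition.block 𝒫 X₂))
-- The input lists have at most `n ^ 2` entries, so the exponent `s` in their length becomes `2 * s`
-- in `n`.
theorem1p10 ℝ = algorithm , s , 2 * s , λ {n} {k} {{n≢0}} G r 0<r 𝒫 ⪯-ord m A large →
  ℕ.≤-trans (within {{ℕ.m^n≢0 n 2}} (encode G r 𝒫 ⪯-ord m A)
    (encode-small G r 𝒫 ⪯-ord m A))
    (ℕ.≤-reflexive (cong (s *_) (ℕ.^-*-assoc n 2 s)))
  , Correctness.solution ℝ G r 0<r 𝒫 ⪯-ord m A large
  where
  open Cost ℝ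
  open Encoding ℝ
  open Semantics ℝ
  s = proj₁ (Complexity.polynomial ℝ)
  within : ∀ {N} .{{_ : NonZero N}} (ρ : Env Input) → SmallEnv N ρ → cost algorithm ρ ≤ s * N ^ s
  within ρ ρˢ = Within.bound (proj₁ (proj₂ (Complexity.polynomial ℝ) ρ ρˢ))
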